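{- Up to Euclidean isometry, the only Eisenstein lattice equable parallelograms with a horizontal diagonal are the parallelograms $P_n=OA_nB_nC_n$, $n\ge 0$, defined in the context; that is, every ELEP having a horizontal diagonal is congruent to $P_n$ for some integer $n\ge0$.
   Context: A planar polygon is equable if its perimeter equals its area. The Eisenstein lattice is $\mathbb{Z}[\omega]\subset\mathbb{C}$, where $\omega=-\frac12+i\frac{\sqrt3}{2}$. An Eisenstein lattice equable parallelogram (ELEP) is an equable parallelogram whose vertices all lie in $\mathbb{Z}[\omega]$. Horizontal means parallel to the real axis ($x$-axis). Let $(u_n)_{n\ge0}$ be defined by $u_0=0$, $u_1=1$, $u_n=4u_{n-1}-u_{n-2}$. In Cartesian coordinates let $O=(0,0)$ and $$A_n=(-6u_n,-2\sqrt3),\quad B_n=(6u_{n+1}-6u_n,0),\quad C_n=(6u_{n+1},2\sqrt3).$$ For each $n\ge0$, $P_n=OA_nB_nC_n$ is the parallelogram with these consecutive vertices; it is an ELEP whose diagonal $OB_n$ is horizontal. -}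

module Defs where

open import Algebra.Apartness.Bundles using (HeytingField; HeytingCommutativeRing)
open import Algebra.Bundles using (CommutativeRing)
import Algebra.Properties.Ring as RingProperties
open import Data.Empty using (⊥-elim)
open import Data.Integer as ℤ using (ℤ; +_; -[1+_])
open import Data.Nat as ℕ using (ℕ; zero; suc)
open import Data.Product using (_×_; _,_; proj₁; ∃-syntax)
open import Data.Sum using (_⊎_; inj₁; inj₂)
open import Function.Bundles using (_⇔_; Equivalence)
open import Level using (Level) renaming (_⊔_ to _⊔ˡ_; suc to sucˡ)
open import Relation.Binary.Core using (Rel)
open import Relation.Binary.Lattice.Definitions using (Supremum)
open import Relation.Binary.Structures using (IsStrictPartialOrder)
open import Relation.Nullary using (¬_)

-- Ordered fields in the constructive sense: a tight apartness replaces ≉, and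
-- ≤ is the negation of >. Binary joins provide the absolute value.
record OrderedField (c ℓ₁ ℓ₂ : Level) : Set (sucˡ (c ⊔ˡ ℓ₁ ⊔ˡ ℓ₂)) where
  infix  4 _<_ _≤_
  infixl 6 _⊔_

  field
    heytingField : HeytingField c ℓ₁ ℓ₂

  open HeytingField heytingField public

  field
    _<_                  : Rel Carrier ℓ₂
    isStrictPartialOrder : IsStrictPartialOrder _≈_ _<_
    #⇔<⊎>                : ∀ x y → x # y ⇔ (x < y ⊎ y < x)
    +-monoˡ-<            : ∀ z {x y} → x < y → x + z < y + z
    *-pos                : ∀ {x y} → 0# < x → 0# < y → 0# < x * y

  _≤_ : Rel Carrier ℓ₂
  x ≤ y = ¬ (y < x)

  field
    _⊔_        : Carrier → Carrier → Carrier
    ⊔-supremum : Supremum _≤_ _⊔_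

  open IsStrictPartialOrder isStrictPartialOrder public
    using (<-resp-≈; <-respˡ-≈; <-respʳ-≈)
    renaming (irrefl to <-irrefl; trans to <-trans; asym to <-asym)

  commutativeRing : CommutativeRing c ℓ₁
  commutativeRing = HeytingCommutativeRing.commutativeRing heytingCommutativeRing

  open CommutativeRing commutativeRing public using (ring; +-rawMonoid)
  open import Algebra.Definitions.RawMonoid +-rawMonoid public
    using () renaming (_×_ to _·_)
  open RingProperties ring using (-‿involutive; -‿distribˡ-*; -0#≈0#)

  fromℕ : ℕ → Carrier
  fromℕ n = n · 1#

  fromℤ : ℤ → Carrier
  fromℤ (+ n)    = fromℕ n
  fromℤ -[1+ n ] = - fromℕ (suc n)

  ∣_∣ : Carrier → Carrier
  ∣ x ∣ = x ⊔ (- x)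

  1#0 : 1# # 0#
  1#0 = invertible⇒# (1# , trans (*-identityˡ _) 1-0≈1 , trans (*-identityʳ _) 1-0≈1)
    where
    1-0≈1 : 1# - 0# ≈ 1#
    1-0≈1 = trans (+-congˡ -0#≈0#) (+-identityʳ 1#)

  0<1 : 0# < 1#
  0<1 with Equivalence.to (#⇔<⊎> 1# 0#) 1#0
  ... | inj₂ 0<1′ = 0<1′
  ... | inj₁ 1<0  = ⊥-elim (<-asym 1<0 (<-respʳ-≈ -1*-1≈1 (*-pos 0<-1 0<-1)))
    where
    0<-1 : 0# < - 1#
    0<-1 = <-respˡ-≈ (-‿inverseʳ 1#) (<-respʳ-≈ (+-identityˡ _) (+-monoˡ-< (- 1#) 1<0))

    -1*-1≈1 : - 1# * - 1# ≈ 1#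
    -1*-1≈1 = trans (sym (-‿distribˡ-* 1# (- 1#)))
                    (trans (-‿cong (*-identityˡ (- 1#))) (-‿involutive 1#))

  2#0 : (1# + 1#) # 0#
  2#0 = Equivalence.from (#⇔<⊎> (1# + 1#) 0#)
          (inj₂ (<-trans 0<1 (<-respˡ-≈ (+-identityˡ 1#) (+-monoˡ-< 1# 0<1))))

  ½ : Carrier
  ½ = proj₁ (#⇒invertible 2#0)

-- The real numbers, characterised as a Cauchy-complete Archimedean ordered
-- field. The axioms hold of the constructive (Bishop) reals and, given excluded
-- middle, of the classical reals.
record RealNumbers (c ℓ₁ ℓ₂ : Level) : Set (sucˡ (c ⊔ˡ ℓ₁ ⊔ˡ ℓ₂)) where
  field
    orderedField : OrderedField c ℓ₁ ℓ₂

  open OrderedField orderedField public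

  IsCauchy : (ℕ → Carrier) → Set (c ⊔ˡ ℓ₂)
  IsCauchy s = ∀ ε → 0# < ε →
    ∃[ N ] ∀ m n → N ℕ.≤ m → N ℕ.≤ n → ∣ s m - s n ∣ < ε

  _ConvergesTo_ : (ℕ → Carrier) → Carrier → Set (c ⊔ˡ ℓ₂)
  s ConvergesTo l = ∀ ε → 0# < ε →
    ∃[ N ] ∀ n → N ℕ.≤ n → ∣ s n - l ∣ < ε

  infix 9 √_

  field
    archimedean : ∀ x → ∃[ n ] x < fromℕ n
    complete    : ∀ s → IsCauchy s → ∃[ l ] s ConvergesTo l

    -- √ x is unspecified unless 0 ≤ x. Square roots of non-negative numbers
    -- exist by completeness, so this only gives them a name.
    √_          : Carrier → Carrier
    √-cong      : ∀ {x y} → x ≈ y → √ x ≈ √ y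
    √-nonneg    : ∀ {x} → 0# ≤ x → 0# ≤ √ x
    √-square    : ∀ {x} → 0# ≤ x → √ x * √ x ≈ x

u : ℕ → ℤ
u zero          = + 0
u (suc zero)    = + 1
u (suc (suc n)) = + 4 ℤ.* u (suc n) ℤ.- u n

module Plane {c ℓ₁ ℓ₂ : Level} (ℝ : RealNumbers c ℓ₁ ℓ₂) where
  open RealNumbers ℝ

  record Point : Set c where
    constructor ⟨_,_⟩
    field
      x : Carrier
      y : Carrier

  open Point public

  infix  4 _≈ᴾ_ _∈ℤ[ω]
  infixl 6 _+ᴾ_ _-ᴾ_
  infixr 7 _*ᴾ_

  _≈ᴾ_ : Point → Point → Set ℓ₁
  p ≈ᴾ q = x p ≈ x q × y p ≈ y q

  _+ᴾ_ _-ᴾ_ : Point → Point → Point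
  p +ᴾ q = ⟨ x p + x q , y p + y q ⟩
  p -ᴾ q = ⟨ x p - x q , y p - y q ⟩

  _*ᴾ_ : Carrier → Point → Point
  r *ᴾ p = ⟨ r * x p , r * y p ⟩

  dist : Point → Point → Carrier
  dist p q = √ ((x p - x q) * (x p - x q) + (y p - y q) * (y p - y q))

  cross : Point → Point → Carrier
  cross p q = x p * y q - y p * x q

  1ᴾ ω : Point
  1ᴾ = ⟨ 1# , 0# ⟩
  ω  = ⟨ - ½ , ½ * √ (fromℕ 3) ⟩

  _∈ℤ[ω] : Point → Set ℓ₁
  p ∈ℤ[ω] = ∃[ a ] ∃[ b ] p ≈ᴾ fromℤ a *ᴾ 1ᴾ +ᴾ fromℤ b *ᴾ ω

  -- A quadrilateral is given by its consecutive vertices.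
  record Quadrilateral : Set c where
    constructor quad
    field
      v₀ v₁ v₂ v₃ : Point

  open Quadrilateral public

  perimeter : Quadrilateral → Carrier
  perimeter (quad a b c d) = dist a b + dist b c + dist c d + dist d a

  -- The shoelace formula.
  area : Quadrilateral → Carrier
  area (quad a b c d) = ½ * ∣ cross a b + cross b c + cross c d + cross d a ∣

  Equable : Quadrilateral → Set ℓ₁
  Equable Q = perimeter Q ≈ area Q

  -- The second condition excludes degenerate (collinear) vertices.
  IsParallelogram : Quadrilateral → Set ℓ₁
  IsParallelogram (quad a b c d) =
    (b -ᴾ a ≈ᴾ c -ᴾ d) × ¬ (cross (b -ᴾ a) (d -ᴾ a) ≈ 0#)

  HasEisensteinVertices : Quadrilateral → Set ℓ₁
  HasEisensteinVertices (quad a b c d) =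
    a ∈ℤ[ω] × b ∈ℤ[ω] × c ∈ℤ[ω] × d ∈ℤ[ω]

  record IsELEP (Q : Quadrilateral) : Set ℓ₁ where
    field
      isParallelogram       : IsParallelogram Q
      equable               : Equable Q
      hasEisensteinVertices : HasEisensteinVertices Q

  Horizontal : Point → Point → Set ℓ₁
  Horizontal p q = y p ≈ y q

  HasHorizontalDiagonal : Quadrilateral → Set ℓ₁
  HasHorizontalDiagonal (quad a b c d) = Horizontal a c ⊎ Horizontal b d

  IsIsometry : (Point → Point) → Set (c ⊔ˡ ℓ₁)
  IsIsometry f = ∀ p q → dist (f p) (f q) ≈ dist p q

  mapᵠ : (Point → Point) → Quadrilateral → Quadrilateral
  mapᵠ f (quad a b c d) = quad (f a) (f b) (f c) (f d)

  -- Two lists of consecutive vertices describe the same polygon when they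
  -- differ by the choice of starting vertex and of direction of travel.
  data SamePolygon : Quadrilateral → Quadrilateral → Set (c ⊔ˡ ℓ₁) where
    same    : ∀ {a b c d a′ b′ c′ d′} →
              a ≈ᴾ a′ → b ≈ᴾ b′ → c ≈ᴾ c′ → d ≈ᴾ d′ →
              SamePolygon (quad a b c d) (quad a′ b′ c′ d′)
    rotate  : ∀ {a b c d R} →
              SamePolygon (quad b c d a) R → SamePolygon (quad a b c d) R
    reverse : ∀ {a b c d R} →
              SamePolygon (quad d c b a) R → SamePolygon (quad a b c d) R

  Congruent : Quadrilateral → Quadrilateral → Set (c ⊔ˡ ℓ₁)
  Congruent Q R = ∃[ f ] IsIsometry f × SamePolygon (mapᵠ f Q) R

  2√3 : Carrier
  2√3 = fromℕ 2 * √ (fromℕ 3)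

  O : Point
  O = ⟨ 0# , 0# ⟩

  A B C : ℕ → Point
  A n = ⟨ fromℤ (ℤ.- (+ 6 ℤ.* u n)) , - 2√3 ⟩
  B n = ⟨ fromℤ (+ 6 ℤ.* u (suc n) ℤ.- + 6 ℤ.* u n) , 0# ⟩
  C n = ⟨ fromℤ (+ 6 ℤ.* u (suc n)) , 2√3 ⟩

  P : ℕ → Quadrilateral
  P n = quad O (A n) (B n) (C n)

module Submission where

-- Let the diagonal be p + q with p = α₁ + β ω and q = α₂ − β ω, and put K = β (α₁ + α₂).
-- Squaring "perimeter = area" twice shows that ∣p∣² = 3 a² and ∣q∣² = 3 b² for integers a, b
-- with 4 (a + b) = K. Splitting off the factors 3 leaves 3 X² + β² = 4 a²,
-- 3 Y² + β² = 4 b² and 4 (a + b) = 3 β M, where X + Y = 2 M, and eliminating a and b gives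
--   (3 β² − 16) (3 β² M² − 16 E²) = 16 β⁴,   X = M + E.
-- Hence 3 β² − 16 divides 4096, so β = ± 2, which contradicts a b ≥ 0, or β = ± 4. In the latter
-- case X = 4 x and Y = − 4 y with x² + y² = 1 + 4 x y, and Vieta jumping identifies x, y with
-- consecutive terms of u up to order and a common sign.

open import Defs
open import Algebra.Bundles using (CommutativeRing)
import Algebra.Properties.Ring as RingProperties
import Algebra.Properties.Semiring.Mult as SemiringMult
import Algebra.Solver.Ring as RingSolver
open import Algebra.Solver.Ring.AlmostCommutativeRing
  using (fromCommutativeRing; _-Raw-AlmostCommutative⟶_)
open import Data.Empty using (⊥; ⊥-elim)
open import Data.Integer as ℤ using (ℤ; +_; -[1+_]; 0ℤ)
import Data.Integer.Properties as ℤₚ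
open import Data.Integer.Tactic.RingSolver using (solve-∀)
open import Data.Maybe.Base using (map)
open import Data.Nat as ℕ using (ℕ; zero; suc)
import Data.Nat.Properties as ℕₚ
open import Data.Product using (_×_; _,_; proj₁; proj₂; ∃-syntax)
open import Data.Sum using (_⊎_; inj₁; inj₂)
open import Function.Bundles using (Equivalence)
import Relation.Binary.PropositionalEquality as ≡
open ≡ using (_≡_; _≢_)
import Relation.Binary.Reasoning.Setoid as SetoidReasoning
open import Relation.Nullary using (¬_; yes; no)
open import Relation.Nullary.Decidable using (dec⇒maybe; from-yes; toWitness; _→-dec_; _⊎-dec_)

-- Write s₁, s₂ for the side lengths. Equability says s₁ + s₂ = √3 ∣`K`∣ / 4, and its square shows
-- that s₁ s₂ is rational; hence so is s₁ (s₁ + s₂), which forces s₁, and likewise s₂, to be a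
-- rational multiple of √3. The second squaring cannot tell s₁ + s₂ from ∣s₁ - s₂∣, and the latter
-- does occur: `α₁` = 13, `α₂` = -1, `β` = 2 satisfies the squared equation. Therefore `L` ≥ 0
-- travels along with `L`² = 1024 `N₁` `N₂`; together with `K` ≠ 0 these are the only facts that the
-- integer argument receives. The half sum `M` and the half difference `E` of `X` and `Y` are chosen
-- because 4 (a + b) = 3 β M and (a - b) β = 4 E are linear in them. The order on the reals is not
-- decidable. Case distinctions are made over the integers, or under a double negation where the
-- goal is an equation or a negation.

module Arithmetic where
  open import Data.Integer hiding (suc)
  open import Data.Integer.Divisibility.Signed
    using (divides; ∣⇒∣ᵤ; ∣ᵤ⇒∣) renaming (_∣_ to _∣ℤ_)
  open import Data.Integer.Properties
    using (*-cancelˡ-≡; *-cancelʳ-≡; *-comm; *-zeroʳ; abs-*; pos-*; ∣i+j∣≤∣i∣+∣j∣)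
  open import Data.Integer.Tactic.RingSolver using (solve)
  open import Data.List.Base using ([]; _∷_)
  open import Data.Nat.Coprimality using (Coprime; coprime-/gcd; coprime-divisor)
  import Data.Nat.Divisibility as ℕ∣
  open import Data.Nat.DivMod using (m/n*n≡m)
  open import Data.Nat.GCD using (gcd; gcd[m,n]∣m; gcd[m,n]∣n; gcd[m,n]≡0⇒m≡0)
  open import Data.Nat.Induction using (<-wellFounded)
  open import Data.Nat.Primality using (Prime; prime?; euclidsLemma; prime[2])
  import Data.Nat.Tactic.RingSolver as ℕSolver
  open import Induction.WellFounded using (Acc; acc)
  open ≡ hiding (_≡_; _≢_)

  -- The equation x² + y² = 1 + 4 x y

  -- Vieta jumping: (x , y) ↦ (y , 4 y − x).
  vieta : ∀ x y → Acc ℕ._<_ y → y ℕ.≤ x →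
    x ℕ.* x ℕ.+ y ℕ.* y ≡ 1 ℕ.+ 4 ℕ.* (x ℕ.* y) →
    ∃[ n ] u (suc n) ≡ + x × u n ≡ + y
  vieta x y (acc rec) y≤x eq with y ℕ.≟ 0
  ... | yes refl = 0 , cong +_ (sym (ℕₚ.m*n≡1⇒m≡1 x x x*x≡1)) , refl
    where
    open ≡-Reasoning
    x*x≡1 : x ℕ.* x ≡ 1
    x*x≡1 = begin
      x ℕ.* x                     ≡⟨ ℕSolver.solve (x ∷ []) ⟩
      x ℕ.* x ℕ.+ 0 ℕ.* 0         ≡⟨ eq ⟩
      1 ℕ.+ 4 ℕ.* (x ℕ.* 0)       ≡⟨ ℕSolver.solve (x ∷ []) ⟩
      1                           ∎
  ... | no y≢0 =
    let z<y = ℕₚ.≰⇒> (λ y≤z → ℕₚ.<-irrefl y²≡1+xz (ℕ.s≤s (ℕₚ.*-mono-≤ y≤x y≤z)))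
        n , u[1+n]≡y , u[n]≡z = vieta y z (rec z<y) (ℕₚ.<⇒≤ z<y) eq′
    in suc n , jump n u[1+n]≡y u[n]≡z , u[1+n]≡y
    where
    0<y : 0 ℕ.< y
    0<y = ℕₚ.n≢0⇒n>0 y≢0

    -- If 4 y < x, then x² ≥ x + 4 x y ≥ 1 + 4 x y, and y² > 0 breaks the equation. Thus the
    -- truncated subtraction that defines `z` is exact.
    x≤4y : x ℕ.≤ 4 ℕ.* y
    x≤4y = ℕₚ.≮⇒≥ λ 4y<x → ℕₚ.<-irrefl (sym eq) (begin-strict
      1 ℕ.+ 4 ℕ.* (x ℕ.* y)              ≤⟨ ℕₚ.+-monoˡ-≤ _ (ℕₚ.≤-trans 0<y y≤x) ⟩
      x ℕ.+ 4 ℕ.* (x ℕ.* y)              ≡⟨ ℕSolver.solve (x ∷ y ∷ []) ⟩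
      x ℕ.* (1 ℕ.+ 4 ℕ.* y)              ≤⟨ ℕₚ.*-monoʳ-≤ x 4y<x ⟩
      x ℕ.* x                            <⟨ ℕₚ.m<m+n (x ℕ.* x) (ℕₚ.*-mono-≤ 0<y 0<y) ⟩
      x ℕ.* x ℕ.+ y ℕ.* y                ∎)
      where open ℕₚ.≤-Reasoning

    z : ℕ
    z = 4 ℕ.* y ℕ.∸ x

    x+z≡4y : x ℕ.+ z ≡ 4 ℕ.* y
    x+z≡4y = ℕₚ.m+[n∸m]≡n x≤4y

    -- `z` is quantified so that the ring tactic meets a variable instead of a truncated difference.
    expand : ∀ z → x ℕ.+ z ≡ 4 ℕ.* y → x ℕ.* x ℕ.+ y ℕ.* y ≡ x ℕ.* x ℕ.+ (1 ℕ.+ x ℕ.* z)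
    expand z h = begin
      x ℕ.* x ℕ.+ y ℕ.* y                  ≡⟨ eq ⟩
      1 ℕ.+ 4 ℕ.* (x ℕ.* y)                ≡⟨ ℕSolver.solve (x ∷ y ∷ []) ⟩
      1 ℕ.+ x ℕ.* (4 ℕ.* y)                ≡⟨ cong (λ t → 1 ℕ.+ x ℕ.* t) h ⟨
      1 ℕ.+ x ℕ.* (x ℕ.+ z)                ≡⟨ ℕSolver.solve (x ∷ z ∷ []) ⟩
      x ℕ.* x ℕ.+ (1 ℕ.+ x ℕ.* z)          ∎
      where open ≡-Reasoning

    -- `x` and `z` are the roots of t² - 4 y t + y² - 1, so their product is y² - 1. Since y ≤ x,
    -- this is what makes z smaller than y.
    y²≡1+xz : y ℕ.* y ≡ 1 ℕ.+ x ℕ.* z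
    y²≡1+xz = ℕₚ.+-cancelˡ-≡ (x ℕ.* x) _ _ (expand z x+z≡4y)

    eq′ : y ℕ.* y ℕ.+ z ℕ.* z ≡ 1 ℕ.+ 4 ℕ.* (y ℕ.* z)
    eq′ = begin
      y ℕ.* y ℕ.+ z ℕ.* z               ≡⟨ cong (ℕ._+ z ℕ.* z) y²≡1+xz ⟩
      1 ℕ.+ x ℕ.* z ℕ.+ z ℕ.* z         ≡⟨ cong suc (ℕₚ.*-distribʳ-+ z x z) ⟨
      1 ℕ.+ (x ℕ.+ z) ℕ.* z             ≡⟨ cong (λ t → 1 ℕ.+ t ℕ.* z) x+z≡4y ⟩
      1 ℕ.+ (4 ℕ.* y) ℕ.* z             ≡⟨ cong suc (ℕₚ.*-assoc 4 y z) ⟩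
      1 ℕ.+ 4 ℕ.* (y ℕ.* z)             ∎
      where open ≡-Reasoning

    jump : ∀ n → u (suc n) ≡ + y → u n ≡ + z → u (suc (suc n)) ≡ + x
    jump n p q = begin
      + 4 * u (suc n) - u n      ≡⟨ cong₂ (λ s t → + 4 * s - t) p q ⟩
      + 4 * + y - + z            ≡⟨ cong (_- + z) (ℤₚ.pos-* 4 y) ⟨
      + (4 ℕ.* y) - + z            ≡⟨ cong (λ t → + t - + z) x+z≡4y ⟨
      + x + + z - + z            ≡⟨ cancel (+ x) (+ z) ⟩
      + x                            ∎
      where
      open ≡-Reasoning
      cancel : ∀ s t → s + t - t ≡ s
      cancel = solve-∀

  Unit : ℤ → Set
  Unit ε = ε * ε ≡ + 1

  Consecutive : ℤ → ℤ → Set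
  Consecutive x y = ∃[ n ] (x ≡ u (suc n) × y ≡ u n ⊎ x ≡ u n × y ≡ u (suc n))

  -- Equivalent to (x - 2 y)² - 3 y² = 1, hence the name.
  Pell : ℤ → ℤ → Set
  Pell x y = x * x + y * y ≡ + 1 + + 4 * (x * y)

  pell-ℕ : ∀ a b → Pell (+ a) (+ b) → Consecutive (+ a) (+ b)
  pell-ℕ a b eq with ℕₚ.≤-total b a
  ... | inj₁ b≤a = let n , p , q = vieta a b (<-wellFounded b) b≤a (ℤₚ.+-injective eq⁺)
                   in n , inj₁ (sym p , sym q)
    where
    open ≡-Reasoning
    eq⁺ : + (a ℕ.* a ℕ.+ b ℕ.* b) ≡ + (1 ℕ.+ 4 ℕ.* (a ℕ.* b))
    eq⁺ = begin
      + (a ℕ.* a) + + (b ℕ.* b)         ≡⟨ cong₂ _+_ (ℤₚ.pos-* a a) (ℤₚ.pos-* b b) ⟩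
      + a * + a + + b * + b         ≡⟨ eq ⟩
      + 1 + + 4 * (+ a * + b)       ≡⟨ cong (λ t → + 1 + + 4 * t) (ℤₚ.pos-* a b) ⟨
      + 1 + + 4 * + (a ℕ.* b)         ≡⟨ cong (_+_ (+ 1)) (ℤₚ.pos-* 4 (a ℕ.* b)) ⟨
      + 1 + + (4 ℕ.* (a ℕ.* b))         ∎
  ... | inj₂ a≤b = let n , p , q = vieta b a (<-wellFounded a) a≤b (ℤₚ.+-injective eq⁺)
                   in n , inj₂ (sym q , sym p)
    where
    open ≡-Reasoning
    eq⁺ : + (b ℕ.* b ℕ.+ a ℕ.* a) ≡ + (1 ℕ.+ 4 ℕ.* (b ℕ.* a))
    eq⁺ = begin
      + (b ℕ.* b) + + (a ℕ.* a)         ≡⟨ cong₂ _+_ (ℤₚ.pos-* b b) (ℤₚ.pos-* a a) ⟩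
      + b * + b + + a * + a         ≡⟨ ℤₚ.+-comm (+ b * + b) (+ a * + a) ⟩
      + a * + a + + b * + b         ≡⟨ eq ⟩
      + 1 + + 4 * (+ a * + b)       ≡⟨ cong (λ t → + 1 + + 4 * t) (ℤₚ.*-comm (+ a) (+ b)) ⟩
      + 1 + + 4 * (+ b * + a)       ≡⟨ cong (λ t → + 1 + + 4 * t) (ℤₚ.pos-* b a) ⟨
      + 1 + + 4 * + (b ℕ.* a)         ≡⟨ cong (_+_ (+ 1)) (ℤₚ.pos-* 4 (b ℕ.* a)) ⟨
      + 1 + + (4 ℕ.* (b ℕ.* a))         ∎

  Pell± : ℤ → ℤ → Set
  Pell± x y = ∃[ ε ] Unit ε × Consecutive (ε * x) (ε * y)

  pell-scale : ∀ ε x y → Unit ε → Pell x y → Pell (ε * x) (ε * y)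
  pell-scale ε x y ε²≡1 eq = begin
    ε * x * (ε * x) + ε * y * (ε * y)  ≡⟨ solve (ε ∷ x ∷ y ∷ []) ⟩
    ε * ε * (x * x + y * y)                ≡⟨ cong₂ _*_ ε²≡1 eq ⟩
    + 1 * (+ 1 + + 4 * (x * y))              ≡⟨ solve (x ∷ y ∷ []) ⟩
    + 1 + + 4 * (+ 1 * (x * y))              ≡⟨ cong (λ t → + 1 + + 4 * (t * (x * y))) ε²≡1 ⟨
    + 1 + + 4 * (ε * ε * (x * y))          ≡⟨ solve (ε ∷ x ∷ y ∷ []) ⟩
    + 1 + + 4 * (ε * x * (ε * y))          ∎
    where open ≡-Reasoning

  -- Divisibility between squares

  m²∣n²⇒m∣n : ∀ c m n → m ≢ 0 → n ℕ.* n ≡ c ℕ.* (m ℕ.* m) → m ℕ∣.∣ n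
  m²∣n²⇒m∣n c m n m≢0 n²≡cm² = subst (ℕ∣._∣ n) g≡m (gcd[m,n]∣n m n)
    where
    instance
      g≢0 : ℕ.NonZero (gcd m n)
      g≢0 = ℕ.≢-nonZero λ g≡0 → m≢0 (gcd[m,n]≡0⇒m≡0 g≡0)

    g = gcd m n
    m′ = m ℕ./ g
    n′ = n ℕ./ g

    m≡m′g : m ≡ m′ ℕ.* g
    m≡m′g = sym (m/n*n≡m (gcd[m,n]∣m m n))

    n≡n′g : n ≡ n′ ℕ.* g
    n≡n′g = sym (m/n*n≡m (gcd[m,n]∣n m n))

    coprime : Coprime m′ n′
    coprime = coprime-/gcd m n

    descend : ∀ m′ n′ g .{{_ : ℕ.NonZero g}} → m ≡ m′ ℕ.* g → n ≡ n′ ℕ.* g →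
              n′ ℕ.* n′ ≡ c ℕ.* m′ ℕ.* m′
    descend m′ n′ g p q = ℕₚ.*-cancelʳ-≡ _ _ g (ℕₚ.*-cancelʳ-≡ _ _ g (begin
      n′ ℕ.* n′ ℕ.* g ℕ.* g            ≡⟨ ℕSolver.solve (n′ ∷ g ∷ []) ⟩
      n′ ℕ.* g ℕ.* (n′ ℕ.* g)          ≡⟨ cong₂ ℕ._*_ q q ⟨
      n ℕ.* n                          ≡⟨ n²≡cm² ⟩
      c ℕ.* (m ℕ.* m)                  ≡⟨ cong (c ℕ.*_) (cong₂ ℕ._*_ p p) ⟩
      c ℕ.* (m′ ℕ.* g ℕ.* (m′ ℕ.* g))  ≡⟨ ℕSolver.solve (c ∷ m′ ∷ g ∷ []) ⟩
      c ℕ.* m′ ℕ.* m′ ℕ.* g ℕ.* g      ∎))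
      where open ≡-Reasoning

    -- `m′` divides n′² and is coprime to `n′`, so it divides `n′`; being a common divisor of a
    -- coprime pair, it is 1.
    m′≡1 : m′ ≡ 1
    m′≡1 = coprime (ℕ∣.∣-refl , coprime-divisor coprime m′∣n′²)
      where
      m′∣n′² : m′ ℕ∣.∣ n′ ℕ.* n′
      m′∣n′² = ℕ∣.divides (c ℕ.* m′) (descend m′ n′ g m≡m′g n≡n′g)

    g≡m : g ≡ m
    g≡m = begin
      g          ≡⟨ ℕₚ.*-identityˡ g ⟨
      1 ℕ.* g    ≡⟨ cong (ℕ._* g) m′≡1 ⟨
      m′ ℕ.* g   ≡⟨ m≡m′g ⟨
      m          ∎
      where open ≡-Reasoning

  i²∣j²⇒i∣j : ∀ c i j → i ≢ 0ℤ → j * j ≡ c * (i * i) → i ∣ℤ j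
  i²∣j²⇒i∣j c i j i≢0 j²≡ci² =
    ∣ᵤ⇒∣ (m²∣n²⇒m∣n (∣ c ∣) (∣ i ∣) (∣ j ∣) (λ ∣i∣≡0 → i≢0 (ℤₚ.∣i∣≡0⇒i≡0 ∣i∣≡0)) (begin
      ∣ j ∣ ℕ.* ∣ j ∣             ≡⟨ abs-* j j ⟨
      ∣ j * j ∣                   ≡⟨ cong ∣_∣ j²≡ci² ⟩
      ∣ c * (i * i) ∣             ≡⟨ abs-* c (i * i) ⟩
      ∣ c ∣ ℕ.* ∣ i * i ∣         ≡⟨ cong (∣ c ∣ ℕ.*_) (abs-* i i) ⟩
      ∣ c ∣ ℕ.* (∣ i ∣ ℕ.* ∣ i ∣) ∎))
    where open ≡-Reasoning

  prime[3] : Prime 3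
  prime[3] = from-yes (prime? 3)

  prime∣i²⇒prime∣i : ∀ {p} → Prime p → ∀ q i → i * i ≡ q * + p → + p ∣ℤ i
  prime∣i²⇒prime∣i {p} pr q i eq with euclidsLemma (∣ i ∣) (∣ i ∣) pr p∣∣i∣²
    where
    p∣∣i∣² : p ℕ∣.∣ ∣ i ∣ ℕ.* ∣ i ∣
    p∣∣i∣² = subst (p ℕ∣.∣_) (abs-* i i) (∣⇒∣ᵤ {+ p} (divides q eq))
  ... | inj₁ p∣i = ∣ᵤ⇒∣ p∣i
  ... | inj₂ p∣i = ∣ᵤ⇒∣ p∣i

  -- Signs of the integer solutions

  abs-unit : ∀ i → ∃[ ε ] Unit ε × ε * i ≡ + ∣ i ∣
  abs-unit (+ n)      = + 1 , refl , ℤₚ.*-identityˡ (+ n)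
  abs-unit i@(-[1+ n ]) = -[1+ 0 ] , refl , ℤₚ.-1*i≡-i i

  i*i≡+∣i∣² : ∀ i → i * i ≡ + ∣ i ∣ * + ∣ i ∣
  i*i≡+∣i∣² (+ n)    = refl
  i*i≡+∣i∣² -[1+ n ] = refl

  0≤i² : ∀ i → 0ℤ ≤ i * i
  0≤i² i = subst (0ℤ ≤_) (trans (pos-* (∣ i ∣) (∣ i ∣)) (sym (i*i≡+∣i∣² i))) (+≤+ ℕ.z≤n)

  pell-sym : ∀ x y → Pell x y → Pell y x
  pell-sym x y eq = begin
    y * y + x * x          ≡⟨ ℤₚ.+-comm (y * y) (x * x) ⟩
    x * x + y * y          ≡⟨ eq ⟩
    + 1 + + 4 * (x * y)    ≡⟨ cong (λ t → + 1 + + 4 * t) (*-comm x y) ⟩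
    + 1 + + 4 * (y * x)    ∎
    where open ≡-Reasoning

  -- For opposite signs the equation reads s² + t² + 4 s t = 1 with s, t ≥ 1, but the left side is
  -- at least 6.
  pell-opposite : ∀ m n → ¬ Pell (+ suc m) (- + suc n)
  pell-opposite m n eq = ℕₚ.1+n≢0 (ℕₚ.m+n≡0⇒n≡0 (m ℕ.+ m ℕ.* suc m)
    (ℕₚ.m+n≡0⇒m≡0 _ (ℕₚ.suc-injective (ℤₚ.+-injective sum≡1))))
    where
    open ≡-Reasoning

    transpose : ∀ s t → Pell s (- t) → s * s + t * t + + 4 * (s * t) ≡ + 1
    transpose s t eq = begin
      s * s + t * t + + 4 * (s * t)                    ≡⟨ solve (s ∷ t ∷ []) ⟩
      s * s + - t * - t + + 4 * (s * t)                ≡⟨ cong (_+ + 4 * (s * t)) eq ⟩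
      + 1 + + 4 * (s * - t) + + 4 * (s * t)            ≡⟨ solve (s ∷ t ∷ []) ⟩
      + 1                                              ∎

    sum≡1 : + (suc m ℕ.* suc m ℕ.+ suc n ℕ.* suc n ℕ.+ 4 ℕ.* (suc m ℕ.* suc n)) ≡ + 1
    sum≡1 = begin
      + (suc m ℕ.* suc m) + + (suc n ℕ.* suc n) + + (4 ℕ.* (suc m ℕ.* suc n))
        ≡⟨ cong₂ _+_ (cong₂ _+_ (pos-* (suc m) (suc m)) (pos-* (suc n) (suc n)))
             (trans (pos-* 4 (suc m ℕ.* suc n)) (cong (+ 4 *_) (pos-* (suc m) (suc n)))) ⟩
      + suc m * + suc m + + suc n * + suc n + + 4 * (+ suc m * + suc n)
        ≡⟨ transpose (+ suc m) (+ suc n) eq ⟩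
      + 1  ∎

  pell± : ∀ x y → Pell x y → Pell± x y
  pell± = signs
    where
    scaled : ∀ ε a b {x y} → Unit ε → ε * x ≡ + a → ε * y ≡ + b → Pell x y → Pell± x y
    scaled ε a b {x} {y} ε²≡1 εx≡a εy≡b eq = ε , ε²≡1 ,
      subst₂ Consecutive (sym εx≡a) (sym εy≡b)
        (pell-ℕ a b (subst₂ Pell εx≡a εy≡b (pell-scale ε x y ε²≡1 eq)))

    signs : ∀ x y → Pell x y → Pell± x y
    signs (+ a)       (+ b)     = scaled (+ 1) a b refl (ℤₚ.*-identityˡ (+ a)) (ℤₚ.*-identityˡ (+ b))
    signs -[1+ a ]    -[1+ b ]  = scaled -1ℤ (suc a) (suc b) refl (ℤₚ.-1*i≡-i -[1+ a ]) (ℤₚ.-1*i≡-i -[1+ b ])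
    -- Zero agrees with either sign, so the other entry dictates `ε`.
    signs (+ zero)    -[1+ b ]  = scaled -1ℤ 0 (suc b) refl refl (ℤₚ.-1*i≡-i -[1+ b ])
    signs -[1+ a ]    (+ zero)  = scaled -1ℤ (suc a) 0 refl (ℤₚ.-1*i≡-i -[1+ a ]) refl
    signs (+ suc a)   -[1+ b ] eq = ⊥-elim (pell-opposite a b eq)
    signs x@(-[1+ a ])  y@(+ suc b) eq = ⊥-elim (pell-opposite b a (pell-sym x y eq))

  -- Side lengths as integer multiples of √3

  -- As G² = 3 N₁ (8 K)², the square root of 3 N₁ is an integer.
  three-times-square : ∀ {K N₁ N₂ L} → L ≡ + 3 * (K * K) - + 16 * (N₁ + N₂) →
    K ≢ 0ℤ → L * L ≡ + 1024 * (N₁ * N₂) →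
    ∃[ a ] N₁ ≡ + 3 * (a * a) × L + + 32 * N₁ ≡ + 24 * (K * a)
  three-times-square {K} {N₁} {N₂} {L} refl K≢0 L²≡1024N₁N₂ = root 8K∣G
    where
    open ≡-Reasoning

    instance
      K-nonZero : NonZero K
      K-nonZero = ≢-nonZero K≢0

    -- When `L` is 32 √N₁ √N₂, this is 32 √N₁ (√N₁ + √N₂), a side times a multiple of the perimeter;
    -- replacing the perimeter by the area turns it into 8 √(3 N₁) ∣K∣.
    G = L + + 32 * N₁

    G² : G * G ≡ + 3 * N₁ * (+ 8 * K * (+ 8 * K))
    G² = lemma (L * L) L²≡1024N₁N₂ (square K N₁ N₂)
      where
      square : ∀ K N₁ N₂ → let L = + 3 * (K * K) - + 16 * (N₁ + N₂) in
        (L + + 32 * N₁) * (L + + 32 * N₁) ≡ L * L + + 64 * (N₁ * L) + + 1024 * (N₁ * N₁)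
      square = solve-∀

      collect : ∀ K N₁ N₂ → let L = + 3 * (K * K) - + 16 * (N₁ + N₂) in
        + 1024 * (N₁ * N₂) + + 64 * (N₁ * L) + + 1024 * (N₁ * N₁) ≡ + 3 * N₁ * (+ 8 * K * (+ 8 * K))
      collect = solve-∀

      lemma : ∀ s → s ≡ + 1024 * (N₁ * N₂) → G * G ≡ s + + 64 * (N₁ * L) + + 1024 * (N₁ * N₁) →
        G * G ≡ + 3 * N₁ * (+ 8 * K * (+ 8 * K))
      lemma _ refl p = trans p (collect K N₁ N₂)

    8K∣G : + 8 * K ∣ℤ G
    8K∣G = i²∣j²⇒i∣j (+ 3 * N₁) (+ 8 * K) G 8K≢0 G²
      where
      8K≢0 : + 8 * K ≢ 0ℤ
      8K≢0 8K≡0 = K≢0 (*-cancelˡ-≡ (+ 8) K 0ℤ 8K≡0)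

    root : + 8 * K ∣ℤ G → ∃[ a ] N₁ ≡ + 3 * (a * a) × G ≡ + 24 * (K * a)
    root (divides h G≡8Kh) = third (prime∣i²⇒prime∣i prime[3] N₁ h (trans h²≡3N₁ (*-comm (+ 3) N₁)))
      where
      h²≡3N₁ : h * h ≡ + 3 * N₁
      h²≡3N₁ = *-cancelʳ-≡ _ _ K (*-cancelʳ-≡ _ _ K (*-cancelʳ-≡ _ _ (+ 64) (begin
        h * h * K * K * + 64                 ≡⟨ solve (h ∷ K ∷ []) ⟩
        h * (+ 8 * K) * (h * (+ 8 * K))      ≡⟨ cong₂ _*_ G≡8Kh G≡8Kh ⟨
        G * G                                ≡⟨ G² ⟩
        + 3 * N₁ * (+ 8 * K * (+ 8 * K))     ≡⟨ solve (K ∷ N₁ ∷ []) ⟩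
        + 3 * N₁ * K * K * + 64              ∎)))

      third : + 3 ∣ℤ h → ∃[ a ] N₁ ≡ + 3 * (a * a) × G ≡ + 24 * (K * a)
      third (divides a h≡3a) = a
        , *-cancelˡ-≡ (+ 3) _ _ (begin
            + 3 * N₁               ≡⟨ h²≡3N₁ ⟨
            h * h                  ≡⟨ cong₂ _*_ h≡3a h≡3a ⟩
            a * + 3 * (a * + 3)    ≡⟨ solve (a ∷ []) ⟩
            + 3 * (+ 3 * (a * a))  ∎)
        , (begin
            G                      ≡⟨ G≡8Kh ⟩
            h * (+ 8 * K)          ≡⟨ cong (_* (+ 8 * K)) h≡3a ⟩
            a * + 3 * (+ 8 * K)    ≡⟨ solve (a ∷ K ∷ []) ⟩
            + 24 * (K * a)         ∎)

  -- N₁ = ∣p∣², N₂ = ∣q∣², and the area is √3/2 ∣ K ∣; equability makes L equal to 32 √N₁ √N₂.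
  module _ (α₁ α₂ β : ℤ) where
    K N₁ N₂ L : ℤ
    K = β * (α₁ + α₂)
    N₁ = α₁ * α₁ - α₁ * β + β * β
    N₂ = α₂ * α₂ + α₂ * β + β * β
    L = + 3 * (K * K) - + 16 * (N₁ + N₂)

    -- Y = 2 M − X; the sides p, q have lengths √3 ∣ a ∣ and √3 ∣ b ∣.
    record Triangle : Set where
      field
        X M a b : ℤ
        2α₁-β≡3X : + 2 * α₁ - β ≡ + 3 * X
        2α₂+β≡3Y : + 2 * α₂ + β ≡ + 3 * (+ 2 * M - X)
        3X²+β²≡4a² : + 3 * (X * X) + β * β ≡ + 4 * (a * a)
        3Y²+β²≡4b² : + 3 * ((+ 2 * M - X) * (+ 2 * M - X)) + β * β ≡ + 4 * (b * b)
        4[a+b]≡3βM : + 4 * (a + b) ≡ + 3 * (β * M)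
        M≢0 : M ≢ 0ℤ
        β≢0 : β ≢ 0ℤ
        0≤ab : 0ℤ ≤ a * b

    triangle : K ≢ 0ℤ → 0ℤ ≤ L → L * L ≡ + 1024 * (N₁ * N₂) → Triangle
    triangle K≢0 0≤L L² =
      let a , N₁≡3a² , G≡24Ka = three-times-square {K} {N₁} {N₂} {L} refl K≢0 L²
          b , N₂≡3b² , H≡24Kb = three-times-square {K} {N₂} {N₁} {L}
            (cong (λ t → + 3 * (K * K) - + 16 * t) (ℤₚ.+-comm N₁ N₂)) K≢0
            (trans L² (cong (+ 1024 *_) (*-comm N₁ N₂)))
      in sides a b N₁≡3a² N₂≡3b² (4[a+b]≡K a b G≡24Ka H≡24Kb)
      where
      open ≡-Reasoning

      instance
        K-nonZero : NonZero K
        K-nonZero = ≢-nonZero K≢0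

      -- This is equability again, now linear. The square roots `a` and `b` carry compatible signs
      -- because both are obtained from the same `L` and `K`; adding their equations cancels `N₁`
      -- and `N₂` and leaves 6 K².
      4[a+b]≡K : ∀ a b → L + + 32 * N₁ ≡ + 24 * (K * a) → L + + 32 * N₂ ≡ + 24 * (K * b) →
        + 4 * (a + b) ≡ K
      4[a+b]≡K a b p q = *-cancelˡ-≡ K _ _ (*-cancelˡ-≡ (+ 6) _ _ (begin
        + 6 * (K * (+ 4 * (a + b)))              ≡⟨ factor K a b ⟩
        + 24 * (K * a) + + 24 * (K * b)          ≡⟨ cong₂ _+_ p q ⟨
        L + + 32 * N₁ + (L + + 32 * N₂)          ≡⟨ collect K N₁ N₂ ⟩
        + 6 * (K * K)                            ∎))
        where
        factor : ∀ K a b → + 6 * (K * (+ 4 * (a + b))) ≡ + 24 * (K * a) + + 24 * (K * b)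
        factor = solve-∀

        collect : ∀ K N₁ N₂ → let L = + 3 * (K * K) - + 16 * (N₁ + N₂) in
          L + + 32 * N₁ + (L + + 32 * N₂) ≡ + 6 * (K * K)
        collect = solve-∀

      -- `s` is twice the horizontal extent of the side. As N = 3 a², the number s² = 4 N - 3 β² is
      -- divisible by 3, hence so is `s`, and one factor 3 cancels from the whole equation.
      side : ∀ s N a → s * s + + 3 * (β * β) ≡ + 4 * N → N ≡ + 3 * (a * a) →
        ∃[ X ] s ≡ + 3 * X × + 3 * (X * X) + β * β ≡ + 4 * (a * a)
      side s N a eq refl = quotient (prime∣i²⇒prime∣i prime[3] (+ 4 * (a * a) - β * β) s (begin
        s * s                                                ≡⟨ solve (s ∷ β ∷ []) ⟩
        s * s + + 3 * (β * β) - + 3 * (β * β)                ≡⟨ cong (_- + 3 * (β * β)) eq ⟩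
        + 4 * (+ 3 * (a * a)) - + 3 * (β * β)                ≡⟨ solve (a ∷ β ∷ []) ⟩
        (+ 4 * (a * a) - β * β) * + 3                        ∎))
        where
        quotient : + 3 ∣ℤ s → ∃[ X ] s ≡ + 3 * X × + 3 * (X * X) + β * β ≡ + 4 * (a * a)
        quotient (divides X refl) = X , *-comm X (+ 3) , *-cancelˡ-≡ (+ 3) _ _ (begin
          + 3 * (+ 3 * (X * X) + β * β)                ≡⟨ solve (X ∷ β ∷ []) ⟩
          X * + 3 * (X * + 3) + + 3 * (β * β)          ≡⟨ eq ⟩
          + 4 * (+ 3 * (a * a))                        ≡⟨ solve (a ∷ []) ⟩
          + 3 * (+ 4 * (a * a))                        ∎)

      sides : ∀ a b → N₁ ≡ + 3 * (a * a) → N₂ ≡ + 3 * (b * b) → + 4 * (a + b) ≡ K → Triangle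
      sides a b N₁≡3a² N₂≡3b² 4[a+b]≡K =
        let X , p , 3X²+β²≡4a² = side (+ 2 * α₁ - β) N₁ a (complete₁ α₁ β) N₁≡3a²
            Y , q , 3Y²+β²≡4b² = side (+ 2 * α₂ + β) N₂ b (complete₂ α₂ β) N₂≡3b²
            -- From 2 (α₁ + α₂) = 3 (X + Y) the half sum (X + Y) / 2 equals (α₁ + α₂) / 3. This
            -- expression produces it without a division.
            M = α₁ + α₂ - X - Y
            Y≡2M-X = solve-Y X Y (α₁ + α₂) (double X Y p q)
            K≡3βM = begin
              K                  ≡⟨ cong (β *_) (solve-M X Y (α₁ + α₂) (double X Y p q)) ⟩
              β * (+ 3 * M)      ≡⟨ rotate β M ⟩
              + 3 * (β * M)      ∎
        in record
          { X = X ; M = M ; a = a ; b = b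
          ; 2α₁-β≡3X = p
          ; 2α₂+β≡3Y = trans q (cong (+ 3 *_) Y≡2M-X)
          ; 3X²+β²≡4a² = 3X²+β²≡4a²
          ; 3Y²+β²≡4b² = subst (λ Y → + 3 * (Y * Y) + β * β ≡ + 4 * (b * b)) Y≡2M-X 3Y²+β²≡4b²
          ; 4[a+b]≡3βM = trans 4[a+b]≡K K≡3βM
          ; M≢0 = λ M≡0 → K≢0 (trans K≡3βM
              (trans (cong (λ t → + 3 * (β * t)) M≡0) (cong (+ 3 *_) (*-zeroʳ β))))
          ; β≢0 = λ β≡0 → K≢0 (cong (_* (α₁ + α₂)) β≡0)
          -- Here L = 96 a b, so the sign of `L` becomes the sign of `a * b`.
          ; 0≤ab = ℤₚ.*-cancelˡ-≤-pos 0ℤ (a * b) (+ 96)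
              (subst (0ℤ ≤_) (L≡96ab K N₁ N₂ (sym 4[a+b]≡K) N₁≡3a² N₂≡3b²) 0≤L)
          }
        where
        complete₁ : ∀ α β → (+ 2 * α - β) * (+ 2 * α - β) + + 3 * (β * β) ≡ + 4 * (α * α - α * β + β * β)
        complete₁ = solve-∀

        complete₂ : ∀ α β → (+ 2 * α + β) * (+ 2 * α + β) + + 3 * (β * β) ≡ + 4 * (α * α + α * β + β * β)
        complete₂ = solve-∀

        rotate : ∀ β M → β * (+ 3 * M) ≡ + 3 * (β * M)
        rotate = solve-∀

        double : ∀ X Y → + 2 * α₁ - β ≡ + 3 * X → + 2 * α₂ + β ≡ + 3 * Y → + 2 * (α₁ + α₂) ≡ + 3 * (X + Y)
        double X Y p q = begin
          + 2 * (α₁ + α₂)                        ≡⟨ solve (α₁ ∷ α₂ ∷ β ∷ []) ⟩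
          + 2 * α₁ - β + (+ 2 * α₂ + β)          ≡⟨ cong₂ _+_ p q ⟩
          + 3 * X + + 3 * Y                      ≡⟨ solve (X ∷ Y ∷ []) ⟩
          + 3 * (X + Y)                          ∎

        solve-M : ∀ X Y m → + 2 * m ≡ + 3 * (X + Y) → m ≡ + 3 * (m - X - Y)
        solve-M X Y m eq = begin
          m                              ≡⟨ solve (m ∷ []) ⟩
          + 3 * m - + 2 * m              ≡⟨ cong (_-_ (+ 3 * m)) eq ⟩
          + 3 * m - + 3 * (X + Y)        ≡⟨ solve (m ∷ X ∷ Y ∷ []) ⟩
          + 3 * (m - X - Y)              ∎

        solve-Y : ∀ X Y m → + 2 * m ≡ + 3 * (X + Y) → Y ≡ + 2 * (m - X - Y) - X
        solve-Y X Y m eq = begin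
          Y                                    ≡⟨ solve (X ∷ Y ∷ []) ⟩
          + 3 * (X + Y) - + 3 * X - + 2 * Y    ≡⟨ cong (λ t → t - + 3 * X - + 2 * Y) eq ⟨
          + 2 * m - + 3 * X - + 2 * Y          ≡⟨ solve (m ∷ X ∷ Y ∷ []) ⟩
          + 2 * (m - X - Y) - X                ∎

        L≡96ab : ∀ K N₁ N₂ → K ≡ + 4 * (a + b) → N₁ ≡ + 3 * (a * a) → N₂ ≡ + 3 * (b * b) →
          + 3 * (K * K) - + 16 * (N₁ + N₂) ≡ + 96 * (a * b)
        L≡96ab _ _ _ refl refl refl = solve (a ∷ b ∷ [])

  module _ (α₁ α₂ β : ℤ) where
    -- Twice the abscissa of α + β ω is 2 α - β, and its ordinate is β √3 / 2. So after the
    -- reflections given by `ε` and `δ` the two sides are the vectors `C n`, `A n` in the first case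
    -- of `position`, and `A n`, `C n` in the second.
    record Shape : Set where
      field
        ε δ : ℤ
        ε²≡1 : Unit ε
        δ²≡1 : Unit δ
        n : ℕ
        position :
            ε * (+ 2 * α₁ - β) ≡ + 12 * u (suc n) × ε * (+ 2 * α₂ + β) ≡ - (+ 12 * u n) × δ * β ≡ + 4
          ⊎ ε * (+ 2 * α₁ - β) ≡ - (+ 12 * u n) × ε * (+ 2 * α₂ + β) ≡ + 12 * u (suc n) × δ * β ≡ - + 4

  -- Determination of β

  module _ {α₁ α₂ β : ℤ} (T : Triangle α₁ α₂ β) where
    open Triangle T
    open ≡-Reasoning

    private
      E : ℤ
      E = X - M

    -- The difference of the equations for 4 a² and 4 b² is 4 (a + b) (a - b) = 12 M E. Replacing 4
    -- (a + b) by 3 β M allows the nonzero 3 M to be cancelled.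
    [a-b]β≡4E : (a - b) * β ≡ + 4 * E
    [a-b]β≡4E = *-cancelˡ-≡ M _ _ {{≢-nonZero M≢0}} (*-cancelˡ-≡ (+ 3) _ _ (begin
      + 3 * (M * ((a - b) * β))               ≡⟨ assemble M a b β ⟩
      (a - b) * (+ 3 * (β * M))               ≡⟨ cong ((a - b) *_) 4[a+b]≡3βM ⟨
      (a - b) * (+ 4 * (a + b))               ≡⟨ difference a b ⟩
      + 4 * (a * a) - + 4 * (b * b)           ≡⟨ cong₂ _-_ 3X²+β²≡4a² 3Y²+β²≡4b² ⟨
      + 3 * (X * X) + β * β - (+ 3 * ((+ 2 * M - X) * (+ 2 * M - X)) + β * β)  ≡⟨ expand X M β ⟩
      + 3 * (M * (+ 4 * E))                   ∎))
      where
      assemble : ∀ M a b β → + 3 * (M * ((a - b) * β)) ≡ (a - b) * (+ 3 * (β * M))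
      assemble = solve-∀
      difference : ∀ a b → (a - b) * (+ 4 * (a + b)) ≡ + 4 * (a * a) - + 4 * (b * b)
      difference = solve-∀
      expand : ∀ X M β → + 3 * (X * X) + β * β - (+ 3 * ((+ 2 * M - X) * (+ 2 * M - X)) + β * β)
        ≡ + 3 * (M * (+ 4 * (X - M)))
      expand = solve-∀

    -- 16 β² times 2 (a² + b²) = (a + b)² + (a − b)², with a ± b expressed by M and E.
    main-equation : (+ 3 * (β * β) - + 16) * (+ 3 * (β * β * (M * M)) - + 16 * (E * E))
      ≡ + 16 * (β * β * (β * β))
    main-equation = begin
      (+ 3 * (β * β) - + 16) * (+ 3 * (β * β * (M * M)) - + 16 * (E * E))
        ≡⟨ expand β M X ⟩
      β * β * (+ 3 * (β * M) * (+ 3 * (β * M))) + + 16 * (+ 4 * E * (+ 4 * E))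
        - + 8 * (β * β) * (S + T′) + + 16 * (β * β * (β * β))
        ≡⟨ cong₂ (λ s t → β * β * (s * s) + + 16 * (t * t)
             - + 8 * (β * β) * (S + T′) + + 16 * (β * β * (β * β)))
             4[a+b]≡3βM [a-b]β≡4E ⟨
      β * β * (+ 4 * (a + b) * (+ 4 * (a + b))) + + 16 * ((a - b) * β * ((a - b) * β))
        - + 8 * (β * β) * (S + T′) + + 16 * (β * β * (β * β))
        ≡⟨ cong₂ (λ s t → β * β * (+ 4 * (a + b) * (+ 4 * (a + b))) + + 16 * ((a - b) * β * ((a - b) * β))
             - + 8 * (β * β) * (s + t) + + 16 * (β * β * (β * β))) 3X²+β²≡4a² 3Y²+β²≡4b² ⟩
      β * β * (+ 4 * (a + b) * (+ 4 * (a + b))) + + 16 * ((a - b) * β * ((a - b) * β))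
        - + 8 * (β * β) * (+ 4 * (a * a) + + 4 * (b * b)) + + 16 * (β * β * (β * β))
        ≡⟨ collapse β a b ⟩
      + 16 * (β * β * (β * β))                                               ∎
      where
      S T′ : ℤ
      S = + 3 * (X * X) + β * β
      T′ = + 3 * ((+ 2 * M - X) * (+ 2 * M - X)) + β * β

      expand : ∀ β M X → (+ 3 * (β * β) - + 16) * (+ 3 * (β * β * (M * M)) - + 16 * ((X - M) * (X - M)))
        ≡ β * β * (+ 3 * (β * M) * (+ 3 * (β * M))) + + 16 * (+ 4 * (X - M) * (+ 4 * (X - M)))
          - + 8 * (β * β) * (+ 3 * (X * X) + β * β + (+ 3 * ((+ 2 * M - X) * (+ 2 * M - X)) + β * β))
          + + 16 * (β * β * (β * β))
      expand = solve-∀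

      collapse : ∀ β a b → β * β * (+ 4 * (a + b) * (+ 4 * (a + b))) + + 16 * ((a - b) * β * ((a - b) * β))
        - + 8 * (β * β) * (+ 4 * (a * a) + + 4 * (b * b)) + + 16 * (β * β * (β * β))
        ≡ + 16 * (β * β * (β * β))
      collapse = solve-∀

    -- 9 · 16 β⁴ ≡ 4096 modulo 3 β² − 16.
    t∣4096 : + 3 * (β * β) - + 16 ∣ℤ + 4096
    t∣4096 = divides (+ 9 * W - + 16 * t - + 512) (begin
      + 4096                                                     ≡⟨ complete (+ 16) β ⟩
      + 9 * (+ 16 * (β * β * (β * β))) - (+ 16 * t + + 512) * t
        ≡⟨ cong (λ s → + 9 * s - (+ 16 * t + + 512) * t) main-equation ⟨
      + 9 * (t * W) - (+ 16 * t + + 512) * t                     ≡⟨ factor (+ 16) (+ 512) t W ⟩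
      (+ 9 * W - + 16 * t - + 512) * t                           ∎)
      where
      t W : ℤ
      t = + 3 * (β * β) - + 16
      W = + 3 * (β * β * (M * M)) - + 16 * (E * E)
      -- With t = 3 β² - c this is 9 c β⁴ = c (t + c)², expanded. For c = 16 it gives the constants
      -- 4096 = c³ and 512 = 2 c².
      complete : ∀ c β → c * c * c ≡ + 9 * (c * (β * β * (β * β)))
        - (c * (+ 3 * (β * β) - c) + + 2 * (c * c)) * (+ 3 * (β * β) - c)
      complete = solve-∀
      factor : ∀ c d t W → + 9 * (t * W) - (c * t + d) * t ≡ (+ 9 * W - c * t - d) * t
      factor = solve-∀

    -- Here 3 β² - 16 = -4, so the main equation reads 16 E² = 12 M² + 64. Then 64 a b = 16 (a + b)²
    -- - 16 (a - b)² = 36 M² - 64 E² = -12 M² - 256.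
    β²≢4 : β * β ≢ + 4
    -- 255 is the predecessor of the constant term 256, which `no-solution` takes in the form
    -- `suc r`.
    β²≢4 β²≡4 = no-solution 64 12 255 (a * b) (M * M) 0≤ab (0≤i² M) 64ab+12M²+256≡0
      where
      no-solution : ∀ k l r x y → 0ℤ ≤ x → 0ℤ ≤ y → + k * x + + l * y + + suc r ≢ 0ℤ
      no-solution k l r (+ m) (+ n) _ _ eq = ℕₚ.1+n≢0 (ℕₚ.m+n≡0⇒n≡0 (k ℕ.* m ℕ.+ l ℕ.* n)
        (ℤₚ.+-injective (trans (cong (_+ + suc r) (cong₂ _+_ (pos-* k m) (pos-* l n))) eq)))
      -- `s` stands for `β * β`, so that matching on `refl` can substitute 4 for it.
      conclude : ∀ s → s ≡ + 4 →
        + 4 * (a + b) * (+ 4 * (a + b)) ≡ + 9 * (s * (M * M)) →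
        (a - b) * (a - b) * s ≡ + 16 * (E * E) →
        (+ 3 * s - + 16) * (+ 3 * (s * (M * M)) - + 16 * (E * E)) ≡ + 16 * (s * s) →
        + 64 * (a * b) + + 12 * (M * M) + + 256 ≡ 0ℤ
      conclude _ refl p q r = begin
        + 64 * (a * b) + + 12 * (M * M) + + 256        ≡⟨ expand a b M ⟩
        + 4 * (a + b) * (+ 4 * (a + b)) - + 4 * ((a - b) * (a - b) * + 4) + + 12 * (M * M) + + 256
          ≡⟨ cong₂ (λ s t → s - + 4 * t + + 12 * (M * M) + + 256) p q ⟩
        + 9 * (+ 4 * (M * M)) - + 4 * (+ 16 * (E * E)) + + 12 * (M * M) + + 256  ≡⟨ collapse M E ⟩
        + 256 - (+ 3 * + 4 - + 16) * (+ 3 * (+ 4 * (M * M)) - + 16 * (E * E))    ≡⟨ cong (_-_ (+ 256)) r ⟩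
        0ℤ                                             ∎
        where
        expand : ∀ a b M → + 64 * (a * b) + + 12 * (M * M) + + 256
          ≡ + 4 * (a + b) * (+ 4 * (a + b)) - + 4 * ((a - b) * (a - b) * + 4) + + 12 * (M * M) + + 256
        expand = solve-∀
        collapse : ∀ M E → + 9 * (+ 4 * (M * M)) - + 4 * (+ 16 * (E * E)) + + 12 * (M * M) + + 256
          ≡ + 256 - (+ 3 * + 4 - + 16) * (+ 3 * (+ 4 * (M * M)) - + 16 * (E * E))
        collapse = solve-∀

      [4[a+b]]² : + 4 * (a + b) * (+ 4 * (a + b)) ≡ + 9 * (β * β * (M * M))
      [4[a+b]]² = trans (cong₂ _*_ 4[a+b]≡3βM 4[a+b]≡3βM) (regroup β M)
        where
        regroup : ∀ β M → + 3 * (β * M) * (+ 3 * (β * M)) ≡ + 9 * (β * β * (M * M))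
        regroup = solve-∀

      [[a-b]β]² : (a - b) * (a - b) * (β * β) ≡ + 16 * (E * E)
      [[a-b]β]² = begin
        (a - b) * (a - b) * (β * β)    ≡⟨ regroup (a - b) β ⟩
        (a - b) * β * ((a - b) * β)    ≡⟨ cong₂ _*_ [a-b]β≡4E [a-b]β≡4E ⟩
        + 4 * E * (+ 4 * E)            ≡⟨ square E ⟩
        + 16 * (E * E)                 ∎
        where
        regroup : ∀ d β → d * d * (β * β) ≡ d * β * (d * β)
        regroup = solve-∀
        square : ∀ E → + 4 * E * (+ 4 * E) ≡ + 16 * (E * E)
        square = solve-∀

      64ab+12M²+256≡0 : + 64 * (a * b) + + 12 * (M * M) + + 256 ≡ 0ℤ
      64ab+12M²+256≡0 = conclude (β * β) β²≡4 [4[a+b]]² [[a-b]β]² main-equation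

    -- A divisor of 4096 is at most 4096, so 3 β² ≤ 4112. As 3 · 37² = 4107 and 3 · 38² = 4332,
    -- exactly the values below 38 remain.
    ∣β∣≡4 : ∣ β ∣ ≡ 4
    ∣β∣≡4 = select (candidates {∣ β ∣} ∣β∣<38 divides-4096)
      where
      divides-4096 : ∣ + 3 * (+ ∣ β ∣ * + ∣ β ∣) - + 16 ∣ ℕ∣.∣ 4096
      divides-4096 = subst (λ s → ∣ + 3 * s - + 16 ∣ ℕ∣.∣ 4096) (i*i≡+∣i∣² β) (∣⇒∣ᵤ t∣4096)

      ∣β∣<38 : ∣ β ∣ ℕ.< 38
      ∣β∣<38 = ℕₚ.≰⇒> λ 38≤∣β∣ → ℕₚ.<-irrefl refl (ℕₚ.<-≤-trans {4112} {4332}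
        (toWitness {a? = 4112 ℕ.<? 4332} _)
        (ℕₚ.≤-trans (ℕₚ.*-monoʳ-≤ 3 (ℕₚ.*-mono-≤ 38≤∣β∣ 38≤∣β∣)) 3∣β∣²≤4112))
        where
        3∣β∣²≤4112 : 3 ℕ.* (∣ β ∣ ℕ.* ∣ β ∣) ℕ.≤ 4112
        3∣β∣²≤4112 = bound ∣ β ∣ (ℕ∣.∣⇒≤ divides-4096)
          where
          bound : ∀ n → ∣ + 3 * (+ n * + n) - + 16 ∣ ℕ.≤ 4096 → 3 ℕ.* (n ℕ.* n) ℕ.≤ 4112
          bound n le = ℕₚ.≤-trans (ℕₚ.≤-reflexive (begin
            3 ℕ.* (n ℕ.* n)                             ≡⟨⟩
            ∣ + (3 ℕ.* (n ℕ.* n)) ∣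
              ≡⟨ cong ∣_∣ (trans (pos-* 3 (n ℕ.* n)) (cong (+ 3 *_) (pos-* n n))) ⟩
            ∣ + 3 * (+ n * + n) ∣                       ≡⟨ cong ∣_∣ (add-back (+ 3 * (+ n * + n))) ⟩
            ∣ + 3 * (+ n * + n) - + 16 + + 16 ∣         ∎))
            (ℕₚ.≤-trans (∣i+j∣≤∣i∣+∣j∣ (+ 3 * (+ n * + n) - + 16) (+ 16)) (ℕₚ.+-monoˡ-≤ 16 le))
            where
            add-back : ∀ s → s ≡ s - + 16 + + 16
            add-back = solve-∀

      -- Decided by evaluating the 38 cases.
      candidates : ∀ {n} → n ℕ.< 38 → ∣ + 3 * (+ n * + n) - + 16 ∣ ℕ∣.∣ 4096 → n ≡ 0 ⊎ n ≡ 2 ⊎ n ≡ 4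
      candidates = toWitness {a? = ℕₚ.allUpTo? (λ n →
        (∣ + 3 * (+ n * + n) - + 16 ∣ ℕ∣.∣? 4096) →-dec ((n ℕ.≟ 0) ⊎-dec ((n ℕ.≟ 2) ⊎-dec (n ℕ.≟ 4)))) 38} _

      select : ∣ β ∣ ≡ 0 ⊎ ∣ β ∣ ≡ 2 ⊎ ∣ β ∣ ≡ 4 → ∣ β ∣ ≡ 4
      select (inj₁ ∣β∣≡0)        = ⊥-elim (β≢0 (ℤₚ.∣i∣≡0⇒i≡0 ∣β∣≡0))
      select (inj₂ (inj₁ ∣β∣≡2)) = ⊥-elim (β²≢4 (trans (i*i≡+∣i∣² β) (cong (λ n → + n * + n) ∣β∣≡2)))
      select (inj₂ (inj₂ ∣β∣≡4)) = ∣β∣≡4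

    -- Reduction to the Pell equation for β = ± 4

    pell-point : ∃[ x ] ∃[ y ] X ≡ + 4 * x × + 2 * M - X ≡ - (+ 4 * y) × Pell x y
    pell-point = halve₁ X M (cancel (β * β) β²≡16 main-equation)
      where
      β²≡16 : β * β ≡ + 16
      β²≡16 = trans (i*i≡+∣i∣² β) (cong (λ n → + n * + n) ∣β∣≡4)

      even : ∀ {i} q → i * i ≡ q * + 2 → + 2 ∣ℤ i
      even {i} q = prime∣i²⇒prime∣i prime[2] q i

      cancel : ∀ s → s ≡ + 16 →
        (+ 3 * s - + 16) * (+ 3 * (s * (M * M)) - + 16 * (E * E)) ≡ + 16 * (s * s) →
        X * X ≡ + 2 * (M * M) + + 2 * (M * X) - + 8
      cancel _ refl eq = begin
        X * X                                                        ≡⟨ isolate X M ⟩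
        + 2 * (M * M) + + 2 * (M * X) - (+ 3 * (M * M) - E * E)
          ≡⟨ cong (_-_ (+ 2 * (M * M) + + 2 * (M * X))) 3M²-E²≡8 ⟩
        + 2 * (M * M) + + 2 * (M * X) - + 8                          ∎
        where
        regroup : ∀ c M E → + 2 * (c * c) * (+ 3 * (M * M) - E * E)
          ≡ (+ 3 * c - c) * (+ 3 * (c * (M * M)) - c * (E * E))
        regroup = solve-∀
        -- For β² = 16 the factor 3 β² - 16 is 32 and the other one is 16 (3 M² - E²), while the
        -- right side is 4096 = 512 · 8.
        3M²-E²≡8 : + 3 * (M * M) - E * E ≡ + 8
        3M²-E²≡8 = *-cancelˡ-≡ (+ 512) _ (+ 8) (trans (regroup (+ 16) M E) eq)
        isolate : ∀ X M → X * X ≡ + 2 * (M * M) + + 2 * (M * X) - (+ 3 * (M * M) - (X - M) * (X - M))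
        isolate = solve-∀

      Result : ℤ → ℤ → Set
      Result X M = ∃[ x ] ∃[ y ] X ≡ + 4 * x × + 2 * M - X ≡ - (+ 4 * y) × Pell x y

      -- Three parity steps: X = 2 Z, then M = 2 R, then Z = 2 x. Each equation is the previous one
      -- after substitution and division by 2, and it shows that the square on its left is even.
      halve₁ : ∀ X M → X * X ≡ + 2 * (M * M) + + 2 * (M * X) - + 8 → Result X M
      halve₂ : ∀ X M → M * M ≡ + 2 * (X * X) - + 2 * (M * X) + + 4 → Result (X * + 2) M
      halve₃ : ∀ X M → X * X ≡ + 2 * (M * M) + + 2 * (M * X) - + 2 → Result (X * + 2) (M * + 2)

      halve₁ X M eq = step (even (M * M + M * X - + 4) (trans eq (factor X M)))
        where
        factor : ∀ X M → + 2 * (M * M) + + 2 * (M * X) - + 8 ≡ (M * M + M * X - + 4) * + 2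
        factor = solve-∀
        step : + 2 ∣ℤ X → Result X M
        step (divides Z refl) = halve₂ Z M (*-cancelˡ-≡ (+ 2) _ _ (begin
          + 2 * (M * M)
            ≡⟨ solve (M ∷ Z ∷ []) ⟩
          + 2 * (M * M) + + 2 * (M * (Z * + 2)) - + 8 - + 4 * (M * Z) + + 8
            ≡⟨ cong (λ t → t - + 4 * (M * Z) + + 8) eq ⟨
          Z * + 2 * (Z * + 2) - + 4 * (M * Z) + + 8
            ≡⟨ solve (M ∷ Z ∷ []) ⟩
          + 2 * (+ 2 * (Z * Z) - + 2 * (M * Z) + + 4)                                     ∎))

      halve₂ X M eq = step (even (X * X - M * X + + 2) (trans eq (factor X M)))
        where
        factor : ∀ X M → + 2 * (X * X) - + 2 * (M * X) + + 4 ≡ (X * X - M * X + + 2) * + 2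
        factor = solve-∀
        step : + 2 ∣ℤ M → Result (X * + 2) M
        step (divides R refl) = halve₃ X R (*-cancelˡ-≡ (+ 2) _ _ (begin
          + 2 * (X * X)
            ≡⟨ solve (R ∷ X ∷ []) ⟩
          + 2 * (X * X) - + 2 * (R * + 2 * X) + + 4 + + 4 * (R * X) - + 4
            ≡⟨ cong (λ t → t + + 4 * (R * X) - + 4) eq ⟨
          R * + 2 * (R * + 2) + + 4 * (R * X) - + 4
            ≡⟨ solve (R ∷ X ∷ []) ⟩
          + 2 * (+ 2 * (R * R) + + 2 * (R * X) - + 2)                                     ∎))

      halve₃ X M eq = step (even (M * M + M * X - + 1) (trans eq (factor X M)))
        where
        factor : ∀ X M → + 2 * (M * M) + + 2 * (M * X) - + 2 ≡ (M * M + M * X - + 1) * + 2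
        factor = solve-∀
        step : + 2 ∣ℤ X → Result (X * + 2) (M * + 2)
        -- At this stage `M` is half of the original one, so the original 2 M - X equals 4 M - 4 x,
        -- which dictates y = x - M.
        step (divides x refl) = x , x - M , solve (x ∷ []) , solve (M ∷ x ∷ []) , *-cancelˡ-≡ (+ 2) _ _ (begin
          + 2 * (x * x + (x - M) * (x - M))
            ≡⟨ solve (M ∷ x ∷ []) ⟩
          + 2 * (M * M) + + 2 * (M * (x * + 2)) - + 2 + + 4 * (x * x) - + 8 * (M * x) + + 2
            ≡⟨ cong (λ t → t + + 4 * (x * x) - + 8 * (M * x) + + 2) eq ⟨
          x * + 2 * (x * + 2) + + 4 * (x * x) - + 8 * (M * x) + + 2
            ≡⟨ solve (M ∷ x ∷ []) ⟩
          + 2 * (+ 1 + + 4 * (x * (x - M)))                                           ∎)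

    triangle⇒shape : Shape α₁ α₂ β
    triangle⇒shape =
      let x , y , X≡4x , Y≡-4y , pell = pell-point
          ε , ε²≡1 , n , xy = pell± x y pell
          δ , δ²≡1 , δβ≡∣β∣ = abs-unit β
      in orient ε δ ε²≡1 δ²≡1 n (trans δβ≡∣β∣ (cong +_ ∣β∣≡4)) X≡4x Y≡-4y xy
      where
      orient : ∀ ε δ → Unit ε → Unit δ → ∀ n → δ * β ≡ + 4 →
        ∀ {x y} → X ≡ + 4 * x → + 2 * M - X ≡ - (+ 4 * y) →
        (ε * x ≡ u (suc n) × ε * y ≡ u n) ⊎ (ε * x ≡ u n × ε * y ≡ u (suc n)) → Shape α₁ α₂ β
      orient ε δ ε²≡1 δ²≡1 n δβ≡4 {x} {y} X≡4x Y≡-4y (inj₁ (εx , εy)) = record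
        { ε = ε ; δ = δ ; ε²≡1 = ε²≡1 ; δ²≡1 = δ²≡1 ; n = n
        ; position = inj₁
            ( (begin
                ε * (+ 2 * α₁ - β)       ≡⟨ cong (ε *_) (trans 2α₁-β≡3X (cong (+ 3 *_) X≡4x)) ⟩
                ε * (+ 3 * (+ 4 * x))    ≡⟨ solve (ε ∷ x ∷ []) ⟩
                + 12 * (ε * x)           ≡⟨ cong (+ 12 *_) εx ⟩
                + 12 * u (suc n)       ∎)
            , (begin
                ε * (+ 2 * α₂ + β)       ≡⟨ cong (ε *_) (trans 2α₂+β≡3Y (cong (+ 3 *_) Y≡-4y)) ⟩
                ε * (+ 3 * - (+ 4 * y))  ≡⟨ solve (ε ∷ y ∷ []) ⟩
                - (+ 12 * (ε * y))       ≡⟨ cong (λ t → - (+ 12 * t)) εy ⟩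
                - (+ 12 * u n)           ∎)
            , δβ≡4 )
        }
      -- The terms of `u` occur in the opposite order, so the side along `α₁` has to land on `A n`
      -- instead of `C n`. Negating both `ε` and `δ`, a half-turn, achieves this.
      orient ε δ ε²≡1 δ²≡1 n δβ≡4 {x} {y} X≡4x Y≡-4y (inj₂ (εx , εy)) = record
        { ε = - ε ; δ = - δ ; ε²≡1 = trans (neg-square ε) ε²≡1 ; δ²≡1 = trans (neg-square δ) δ²≡1 ; n = n
        ; position = inj₂
            ( (begin
                - ε * (+ 2 * α₁ - β)       ≡⟨ cong (- ε *_) (trans 2α₁-β≡3X (cong (+ 3 *_) X≡4x)) ⟩
                - ε * (+ 3 * (+ 4 * x))    ≡⟨ solve (ε ∷ x ∷ []) ⟩
                - (+ 12 * (ε * x))         ≡⟨ cong (λ t → - (+ 12 * t)) εx ⟩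
                - (+ 12 * u n)             ∎)
            , (begin
                - ε * (+ 2 * α₂ + β)       ≡⟨ cong (- ε *_) (trans 2α₂+β≡3Y (cong (+ 3 *_) Y≡-4y)) ⟩
                - ε * (+ 3 * - (+ 4 * y))  ≡⟨ solve (ε ∷ y ∷ []) ⟩
                + 12 * (ε * y)             ≡⟨ cong (+ 12 *_) εy ⟩
                + 12 * u (suc n)         ∎)
            , trans (sym (ℤₚ.neg-distribˡ-* δ β)) (cong -_ δβ≡4) )
        }
        where
        neg-square : ∀ i → - i * - i ≡ i * i
        neg-square = solve-∀

  shape : ∀ α₁ α₂ β → K α₁ α₂ β ≢ 0ℤ → 0ℤ ≤ L α₁ α₂ β →
    L α₁ α₂ β * L α₁ α₂ β ≡ + 1024 * (N₁ α₁ α₂ β * N₂ α₁ α₂ β) → Shape α₁ α₂ β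
  shape α₁ α₂ β K≢0 0≤L L² = triangle⇒shape (triangle α₁ α₂ β K≢0 0≤L L²)

  0≤i²-ij+j² : ∀ i j → 0ℤ ≤ i * i - i * j + j * j
  0≤i²-ij+j² i j = ℤₚ.*-cancelˡ-≤-pos 0ℤ _ (+ 4) (≡.subst (0ℤ ≤_) (complete i j)
    (ℤₚ.+-mono-≤ (0≤i² (+ 2 * i - j)) (ℤₚ.*-monoˡ-≤-nonNeg (+ 3) (0≤i² j))))
    where
    complete : ∀ i j → (+ 2 * i - j) * (+ 2 * i - j) + + 3 * (j * j)
      ≡ + 4 * (i * i - i * j + j * j)
    complete = solve-∀

-- Ordered fields: embedded integers, stable equality, absolute value

module FieldProperties {c ℓ₁ ℓ₂} (F : OrderedField c ℓ₁ ℓ₂) where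
  open OrderedField F
  open CommutativeRing commutativeRing using (semiring)
  open RingProperties ring using (-‿involutive; -‿distribˡ-*; -‿distribʳ-*; -0#≈0#; -‿+-comm)
  open SemiringMult semiring using (×-homo-+; ×1-homo-*)
  module ≈-Reasoning = SetoidReasoning setoid
  open ≈-Reasoning

  fromℤ-cong : ∀ {i j} → i ≡ j → fromℤ i ≈ fromℤ j
  fromℤ-cong ≡.refl = refl

  fromℤ-neg : ∀ i → fromℤ (ℤ.- i) ≈ - fromℤ i
  fromℤ-neg (+ zero)  = sym -0#≈0#
  fromℤ-neg (+ suc n) = refl
  fromℤ-neg -[1+ n ]  = sym (-‿involutive _)

  fromℤ-⊖ : ∀ m n → fromℤ (m ℤ.⊖ n) ≈ fromℕ m - fromℕ n
  fromℤ-⊖ m zero = begin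
    fromℕ m            ≈⟨ +-identityʳ _ ⟨
    fromℕ m + 0#       ≈⟨ +-congˡ -0#≈0# ⟨
    fromℕ m - 0#       ∎
  fromℤ-⊖ zero (suc n) = sym (+-identityˡ _)
  fromℤ-⊖ (suc m) (suc n) = begin
    fromℤ (suc m ℤ.⊖ suc n)                         ≈⟨ fromℤ-cong (ℤₚ.[1+m]⊖[1+n]≡m⊖n m n) ⟩
    fromℤ (m ℤ.⊖ n)                                 ≈⟨ fromℤ-⊖ m n ⟩
    fromℕ m - fromℕ n
      ≈⟨ +-congʳ (trans (+-assoc _ _ _) (trans (+-congˡ (-‿inverseʳ 1#)) (+-identityʳ _))) ⟨
    fromℕ m + 1# - 1# - fromℕ n                     ≈⟨ +-assoc _ _ _ ⟩
    fromℕ m + 1# + (- 1# - fromℕ n)                 ≈⟨ +-cong (+-comm _ _) (-‿+-comm 1# (fromℕ n)) ⟩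
    fromℕ (suc m) - fromℕ (suc n)                   ∎

  fromℤ-+ : ∀ i j → fromℤ (i ℤ.+ j) ≈ fromℤ i + fromℤ j
  fromℤ-+ (+ m)    (+ n)    = ×-homo-+ 1# m n
  fromℤ-+ (+ m)    -[1+ n ] = fromℤ-⊖ m (suc n)
  fromℤ-+ -[1+ m ] (+ n)    = trans (fromℤ-⊖ n (suc m)) (+-comm _ _)
  fromℤ-+ -[1+ m ] -[1+ n ] = begin
    - fromℕ (suc (suc (m ℕ.+ n)))        ≈⟨ -‿cong (fromℤ-cong (≡.cong (λ k → + suc k) (ℕₚ.+-suc m n))) ⟨
    - fromℕ (suc m ℕ.+ suc n)            ≈⟨ -‿cong (×-homo-+ 1# (suc m) (suc n)) ⟩
    - (fromℕ (suc m) + fromℕ (suc n))    ≈⟨ -‿+-comm _ _ ⟨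
    - fromℕ (suc m) - fromℕ (suc n)      ∎

  fromℤ-+* : ∀ m j → fromℤ (+ m ℤ.* j) ≈ fromℕ m * fromℤ j
  fromℤ-+* m (+ n)    = trans (fromℤ-cong (≡.sym (ℤₚ.pos-* m n))) (×1-homo-* m n)
  fromℤ-+* m -[1+ n ] = begin
    fromℤ (+ m ℤ.* -[1+ n ])         ≈⟨ fromℤ-cong (ℤₚ.neg-distribʳ-* (+ m) (+ suc n)) ⟨
    fromℤ (ℤ.- (+ m ℤ.* + suc n))    ≈⟨ fromℤ-neg (+ m ℤ.* + suc n) ⟩
    - fromℤ (+ m ℤ.* + suc n)        ≈⟨ -‿cong (fromℤ-+* m (+ suc n)) ⟩
    - (fromℕ m * fromℕ (suc n))      ≈⟨ -‿distribʳ-* _ _ ⟩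
    fromℕ m * - fromℕ (suc n)        ∎

  fromℤ-* : ∀ i j → fromℤ (i ℤ.* j) ≈ fromℤ i * fromℤ j
  fromℤ-* (+ m)    j = fromℤ-+* m j
  fromℤ-* -[1+ m ] j = begin
    fromℤ (-[1+ m ] ℤ.* j)           ≈⟨ fromℤ-cong (ℤₚ.neg-distribˡ-* (+ suc m) j) ⟨
    fromℤ (ℤ.- (+ suc m ℤ.* j))      ≈⟨ fromℤ-neg (+ suc m ℤ.* j) ⟩
    - fromℤ (+ suc m ℤ.* j)          ≈⟨ -‿cong (fromℤ-+* (suc m) j) ⟩
    - (fromℕ (suc m) * fromℤ j)      ≈⟨ -‿distribˡ-* _ _ ⟩
    - fromℕ (suc m) * fromℤ j        ∎

  fromℤ-morphism : ℤ.+-*-rawRing -Raw-AlmostCommutative⟶ fromCommutativeRing commutativeRing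
  fromℤ-morphism = record
    { ⟦_⟧    = fromℤ
    ; +-homo = fromℤ-+
    ; *-homo = fromℤ-*
    ; -‿homo = fromℤ-neg
    ; 0-homo = refl
    ; 1-homo = +-identityʳ 1#
    }

  module Solver = RingSolver ℤ.+-*-rawRing (fromCommutativeRing commutativeRing) fromℤ-morphism
    (λ i j → map fromℤ-cong (dec⇒maybe (i ℤₚ.≟ j)))

  <⇒¬≈ : ∀ {x y} → x < y → ¬ (x ≈ y)
  <⇒¬≈ x<y x≈y = <-irrefl x≈y x<y

  ≤-reflexive : ∀ {x y} → x ≈ y → x ≤ y
  ≤-reflexive x≈y y<x = <-irrefl (sym x≈y) y<x

  -- `≤` negates `>`, so the two hypotheses together refute `x # y`, and the apartness is tight.
  ≤-antisym : ∀ {x y} → x ≤ y → y ≤ x → x ≈ y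
  ≤-antisym {x} {y} x≤y y≤x = proj₁ (tight x y) λ x#y → apart (Equivalence.to (#⇔<⊎> x y) x#y)
    where
    apart : x < y ⊎ y < x → ⊥
    apart (inj₁ x<y) = y≤x x<y
    apart (inj₂ y<x) = x≤y y<x

  -- Both inequalities that make up an equation are negations, and negations survive double
  -- negation.
  ≈-stable : ∀ {x y} → ¬ ¬ (x ≈ y) → x ≈ y
  ≈-stable ¬¬x≈y = ≤-antisym (λ y<x → ¬¬x≈y λ x≈y → <-irrefl (sym x≈y) y<x) (λ x<y → ¬¬x≈y (<⇒¬≈ x<y))

  ≤-respʳ-≈ : ∀ {x y z} → y ≈ z → x ≤ y → x ≤ z
  ≤-respʳ-≈ y≈z x≤y z<x = x≤y (<-respˡ-≈ (sym y≈z) z<x)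

  ∣x∣≈ : ∀ {x y} → x ≤ y → - x ≤ y → y ≤ ∣ x ∣ → ∣ x ∣ ≈ y
  ∣x∣≈ {x} {y} x≤y -x≤y = ≤-antisym (proj₂ (proj₂ (⊔-supremum x (- x))) y x≤y -x≤y)

  x≤∣x∣ : ∀ x → x ≤ ∣ x ∣
  x≤∣x∣ x = proj₁ (⊔-supremum x (- x))

  -x≤∣x∣ : ∀ x → - x ≤ ∣ x ∣
  -x≤∣x∣ x = proj₁ (proj₂ (⊔-supremum x (- x)))

  ∣∣-cong : ∀ {x y} → x ≈ y → ∣ x ∣ ≈ ∣ y ∣
  ∣∣-cong x≈y = ≤-antisym (half x≈y) (half (sym x≈y))
    where
    half : ∀ {x y} → x ≈ y → ∣ x ∣ ≤ ∣ y ∣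
    half {x} {y} x≈y = proj₂ (proj₂ (⊔-supremum x (- x))) ∣ y ∣
      (λ ∣y∣<x → x≤∣x∣ y (<-respʳ-≈ x≈y ∣y∣<x)) (λ ∣y∣<-x → -x≤∣x∣ y (<-respʳ-≈ (-‿cong x≈y) ∣y∣<-x))

  -- Equality being stable, one may argue by cases on the sign of x.
  ∣x∣²≈x² : ∀ x → ∣ x ∣ * ∣ x ∣ ≈ x * x
  ∣x∣²≈x² x = ≈-stable λ ¬eq →
    let -x≤x = λ x<-x → ¬eq (trans (*-cong (∣x∣≈-x x<-x) (∣x∣≈-x x<-x)) -x²≈x²)
        ∣x∣≈x = ∣x∣≈ (≤-reflexive refl) -x≤x (x≤∣x∣ x)
    in ¬eq (*-cong ∣x∣≈x ∣x∣≈x)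
    where
    ∣x∣≈-x : x < - x → ∣ x ∣ ≈ - x
    ∣x∣≈-x x<-x = ∣x∣≈ (λ -x<x → <-asym x<-x -x<x) (≤-reflexive refl) (-x≤∣x∣ x)
    -x²≈x² : - x * - x ≈ x * x
    -x²≈x² = solve 1 (λ x → (:- x) :* (:- x) := x :* x) refl x
      where open Solver

  -- `*-pos` speaks of strictly positive factors only, and whether x is positive or zero cannot be
  -- decided. But if x y < 0, then 0 < x would force y ≈ 0 and x y ≈ 0; so x ≈ 0, and again x y ≈ 0.
  0≤xy : ∀ {x y} → 0# ≤ x → 0# ≤ y → 0# ≤ x * y
  0≤xy {x} {y} 0≤x 0≤y xy<0 = <⇒¬≈ xy<0 (trans (*-congʳ x≈0) (zeroˡ y))
    where
    x≈0 : x ≈ 0#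
    x≈0 = ≤-antisym (λ 0<x → <⇒¬≈ xy<0 (trans (*-congˡ (y≈0 0<x)) (zeroʳ x))) 0≤x
      where
      y≈0 : 0# < x → y ≈ 0#
      y≈0 0<x = ≤-antisym (λ 0<y → <-asym xy<0 (*-pos 0<x 0<y)) 0≤y

  0<fromℕ : ∀ n → 0# < fromℕ (suc n)
  0<fromℕ zero    = <-respʳ-≈ (sym (+-identityʳ 1#)) 0<1
  0<fromℕ (suc n) = <-trans (0<fromℕ n) (<-respˡ-≈ (+-identityˡ _) (+-monoˡ-< (fromℕ (suc n)) 0<1))

  fromℤ-negative : ∀ n → fromℤ -[1+ n ] < 0#
  fromℤ-negative n = <-respˡ-≈ (+-identityˡ _)
    (<-respʳ-≈ (-‿inverseʳ _) (+-monoˡ-< (fromℤ -[1+ n ]) (0<fromℕ n)))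

  0≤fromℤ : ∀ {i} → 0ℤ ℤ.≤ i → 0# ≤ fromℤ i
  0≤fromℤ {+ zero}  _ = ≤-reflexive refl
  0≤fromℤ {+ suc n} _ = <-asym (0<fromℕ n)

  0≤fromℤ⁻¹ : ∀ i → 0# ≤ fromℤ i → 0ℤ ℤ.≤ i
  0≤fromℤ⁻¹ (+ n)    _   = ℤ.+≤+ ℕ.z≤n
  0≤fromℤ⁻¹ -[1+ n ] 0≤i = ⊥-elim (0≤i (fromℤ-negative n))

  fromℤ≈0 : ∀ i → fromℤ i ≈ 0# → i ≡ 0ℤ
  fromℤ≈0 (+ zero)  _   = ≡.refl
  fromℤ≈0 (+ suc n) i≈0 = ⊥-elim (<⇒¬≈ (0<fromℕ n) (sym i≈0))
  fromℤ≈0 -[1+ n ]  i≈0 = ⊥-elim (<⇒¬≈ (fromℤ-negative n) i≈0)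

  fromℤ-injective : ∀ i j → fromℤ i ≈ fromℤ j → i ≡ j
  fromℤ-injective i j i≈j = ℤₚ.i-j≡0⇒i≡j i j (fromℤ≈0 (i ℤ.- j) (begin
    fromℤ (i ℤ.- j)          ≈⟨ fromℤ-+ i (ℤ.- j) ⟩
    fromℤ i + fromℤ (ℤ.- j)  ≈⟨ +-cong i≈j (fromℤ-neg j) ⟩
    fromℤ j - fromℤ j        ≈⟨ -‿inverseʳ _ ⟩
    0#                       ∎))

  ½+½≈1 : ½ + ½ ≈ 1#
  ½+½≈1 = begin
    -- The apartness of 2 and 0 provides an inverse of the difference 2 - 0, hence the subtracted
    -- zero.
    ½ + ½                   ≈⟨ solve 1 (λ h → h :+ h := h :* (con (+ 2) :- con (+ 0))) refl ½ ⟩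
    ½ * (fromℤ (+ 2) - 0#)  ≈⟨ *-congˡ (+-congʳ (+-congˡ (+-identityʳ 1#))) ⟩
    ½ * (1# + 1# - 0#)      ≈⟨ proj₁ (proj₂ (#⇒invertible 2#0)) ⟩
    1#                      ∎
    where open Solver

-- Eisenstein integers in Cartesian coordinates

module Geometry {c ℓ₁ ℓ₂} (ℝ : RealNumbers c ℓ₁ ℓ₂) where
  open RealNumbers ℝ
  open Plane ℝ
  open Arithmetic using (Unit; Shape; shape; K; N₁; N₂; L; 0≤i²-ij+j²)
  open FieldProperties orderedField
  open Solver using (solve; _:=_; _:+_; _:*_; _:-_; :-_; con)
  open ≈-Reasoning
  open RingProperties ring using (-‿distribˡ-*)

  √3 : Carrier
  √3 = √ (fromℤ (+ 3))

  √3²≈3 : √3 * √3 ≈ fromℤ (+ 3)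
  √3²≈3 = √-square (0≤fromℤ {+ 3} (ℤ.+≤+ ℕ.z≤n))

  -- The solver interprets its constant 1 as `fromℤ (+ 1)` and treats `½` as an indeterminate.
  -- Computations with halves are therefore arranged around `½ + ½`, which this equation exchanges
  -- for that constant.
  2½≈1 : ½ + ½ ≈ fromℤ (+ 1)
  2½≈1 = trans ½+½≈1 (sym (+-identityʳ 1#))

  fromℤ-minus : ∀ i j → fromℤ (i ℤ.- j) ≈ fromℤ i - fromℤ j
  fromℤ-minus i j = trans (fromℤ-+ i (ℤ.- j)) (+-congˡ (fromℤ-neg j))

  ⟦_,_⟧ : ℤ → ℤ → Point
  ⟦ i , j ⟧ = fromℤ i *ᴾ 1ᴾ +ᴾ fromℤ j *ᴾ ω

  infixr 5 _⨾_
  _⨾_ : ∀ {p q r} → p ≈ᴾ q → q ≈ᴾ r → p ≈ᴾ r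
  (p , q) ⨾ (p′ , q′) = trans p p′ , trans q q′

  ≈ᴾ-refl : ∀ {p} → p ≈ᴾ p
  ≈ᴾ-refl = refl , refl

  ≈ᴾ-sym : ∀ {p q} → p ≈ᴾ q → q ≈ᴾ p
  ≈ᴾ-sym (p , q) = sym p , sym q

  x-coordinate : ∀ {v i j} → v ≈ᴾ ⟦ i , j ⟧ → x v ≈ fromℤ i - fromℤ j * ½
  x-coordinate {v} {i} {j} (xv , _) = begin
    x v                                 ≈⟨ xv ⟩
    fromℤ i * 1# + fromℤ j * - ½        ≈⟨ +-congʳ (*-identityʳ _) ⟩
    fromℤ i + fromℤ j * - ½             ≈⟨ solve 3 (λ a b h → a :+ b :* (:- h) := a :- b :* h)
         refl (fromℤ i) (fromℤ j) ½ ⟩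
    fromℤ i - fromℤ j * ½               ∎

  y-coordinate : ∀ {v i j} → v ≈ᴾ ⟦ i , j ⟧ → y v ≈ fromℤ j * (½ * √3)
  y-coordinate {v} {i} {j} (_ , yv) = begin
    y v                                 ≈⟨ yv ⟩
    fromℤ i * 0# + fromℤ j * (½ * √3)   ≈⟨ +-congʳ (zeroʳ _) ⟩
    0# + fromℤ j * (½ * √3)             ≈⟨ +-identityˡ _ ⟩
    fromℤ j * (½ * √3)                  ∎

  lattice-difference : ∀ {p q i j k l} → p ≈ᴾ ⟦ i , j ⟧ → q ≈ᴾ ⟦ k , l ⟧ → p -ᴾ q ≈ᴾ ⟦ i ℤ.- k , j ℤ.- l ⟧
  lattice-difference {p} {q} {i} {j} {k} {l} (xp , yp) (xq , yq) =
    trans (+-cong xp (-‿cong xq)) (linear 1# (- ½)) , trans (+-cong yp (-‿cong yq)) (linear 0# (½ * √3))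
    where
    linear : ∀ s t → fromℤ i * s + fromℤ j * t - (fromℤ k * s + fromℤ l * t)
      ≈ fromℤ (i ℤ.- k) * s + fromℤ (j ℤ.- l) * t
    linear s t = begin
      fromℤ i * s + fromℤ j * t - (fromℤ k * s + fromℤ l * t)
        ≈⟨ solve 6 (λ i j k l s t → i :* s :+ j :* t :- (k :* s :+ l :* t)
             := (i :- k) :* s :+ (j :- l) :* t)
             refl (fromℤ i) (fromℤ j) (fromℤ k) (fromℤ l) s t ⟩
      (fromℤ i - fromℤ k) * s + (fromℤ j - fromℤ l) * t
        ≈⟨ +-cong (*-congʳ (fromℤ-minus i k)) (*-congʳ (fromℤ-minus j l)) ⟨
      fromℤ (i ℤ.- k) * s + fromℤ (j ℤ.- l) * t  ∎

  norm² : Point → Carrier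
  norm² v = x v * x v + y v * y v

  -- (i - j / 2)² + 3 (j / 2)² is the norm form of ℤ[ω].
  lattice-norm² : ∀ {v i j} → v ≈ᴾ ⟦ i , j ⟧ → norm² v ≈ fromℤ (i ℤ.* i ℤ.- i ℤ.* j ℤ.+ j ℤ.* j)
  lattice-norm² {v} {i} {j} v≈ = begin
    norm² v                      ≈⟨ +-cong (*-cong xv xv) (*-cong yv yv) ⟩
    (a - b * ½) * (a - b * ½) + b * (½ * √3) * (b * (½ * √3))
      ≈⟨ solve 4 (λ a b h r → (a :- b :* h) :* (a :- b :* h) :+ b :* (h :* r) :* (b :* (h :* r))
           := a :* a :- (h :+ h) :* (a :* b) :+ (con (+ 1) :+ r :* r) :* (h :* h :* (b :* b))) refl a b ½ √3 ⟩
    a * a - (½ + ½) * (a * b) + (fromℤ (+ 1) + √3 * √3) * (½ * ½ * (b * b))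
      ≈⟨ +-congˡ (*-congʳ (+-congˡ √3²≈3)) ⟩
    a * a - (½ + ½) * (a * b) + (fromℤ (+ 1) + fromℤ (+ 3)) * (½ * ½ * (b * b))
      ≈⟨ solve 3 (λ a b h → a :* a :- (h :+ h) :* (a :* b) :+ (con (+ 1) :+ con (+ 3)) :* (h :* h :* (b :* b))
           := a :* a :- (h :+ h) :* (a :* b) :+ (h :+ h) :* (h :+ h) :* (b :* b)) refl a b ½ ⟩
    a * a - (½ + ½) * (a * b) + (½ + ½) * (½ + ½) * (b * b)
      ≈⟨ +-cong (+-congˡ (-‿cong (*-congʳ 2½≈1))) (*-congʳ (*-cong 2½≈1 2½≈1)) ⟩
    a * a - fromℤ (+ 1) * (a * b) + fromℤ (+ 1) * fromℤ (+ 1) * (b * b)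
      ≈⟨ solve 2 (λ a b → a :* a :- con (+ 1) :* (a :* b) :+ con (+ 1) :* con (+ 1) :* (b :* b)
           := a :* a :- a :* b :+ b :* b) refl a b ⟩
    a * a - a * b + b * b
      ≈⟨ +-cong (+-cong (fromℤ-* i i) (-‿cong (fromℤ-* i j))) (fromℤ-* j j) ⟨
    fromℤ (i ℤ.* i) - fromℤ (i ℤ.* j) + fromℤ (j ℤ.* j)
      ≈⟨ trans (fromℤ-+ (i ℤ.* i ℤ.- i ℤ.* j) (j ℤ.* j)) (+-congʳ (fromℤ-minus (i ℤ.* i) (i ℤ.* j))) ⟨
    fromℤ (i ℤ.* i ℤ.- i ℤ.* j ℤ.+ j ℤ.* j)  ∎
    where
    a = fromℤ i
    b = fromℤ j
    xv = x-coordinate {v} {i} {j} v≈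
    yv = y-coordinate {v} {i} {j} v≈

  -- `½ * √3` is the area of the fundamental cell spanned by 1 and ω, and the integer is the
  -- determinant in that basis.
  lattice-cross : ∀ {v w i j k l} → v ≈ᴾ ⟦ i , j ⟧ → w ≈ᴾ ⟦ k , l ⟧ →
    cross v w ≈ ½ * √3 * fromℤ (i ℤ.* l ℤ.- j ℤ.* k)
  lattice-cross {v} {w} {i} {j} {k} {l} v≈ w≈ = begin
    cross v w
      ≈⟨ +-cong (*-cong (x-coordinate {v} {i} {j} v≈) (y-coordinate {w} {k} {l} w≈))
           (-‿cong (*-cong (y-coordinate {v} {i} {j} v≈) (x-coordinate {w} {k} {l} w≈))) ⟩
    (fromℤ i - fromℤ j * ½) * (fromℤ l * (½ * √3)) - fromℤ j * (½ * √3) * (fromℤ k - fromℤ l * ½)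
      ≈⟨ solve 6 (λ i j k l h r → (i :- j :* h) :* (l :* (h :* r)) :- j :* (h :* r) :* (k :- l :* h)
           := h :* r :* (i :* l :- j :* k)) refl (fromℤ i) (fromℤ j) (fromℤ k) (fromℤ l) ½ √3 ⟩
    ½ * √3 * (fromℤ i * fromℤ l - fromℤ j * fromℤ k)
      ≈⟨ *-congˡ (+-cong (fromℤ-* i l) (-‿cong (fromℤ-* j k))) ⟨
    ½ * √3 * (fromℤ (i ℤ.* l) - fromℤ (j ℤ.* k))
      ≈⟨ *-congˡ (fromℤ-minus (i ℤ.* l) (j ℤ.* k)) ⟨
    ½ * √3 * fromℤ (i ℤ.* l ℤ.- j ℤ.* k)  ∎

  dist-sym : ∀ p q → dist p q ≈ dist q p
  dist-sym p q = √-cong (solve 4 (λ a b c d → (a :- c) :* (a :- c) :+ (b :- d) :* (b :- d)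
    := (c :- a) :* (c :- a) :+ (d :- b) :* (d :- b)) refl (x p) (y p) (x q) (y q))

  lattice-dist : ∀ {p q i j} → p -ᴾ q ≈ᴾ ⟦ i , j ⟧ → dist p q ≈ √ fromℤ (i ℤ.* i ℤ.- i ℤ.* j ℤ.+ j ℤ.* j)
  lattice-dist {p} {q} {i} {j} p-q≈ = √-cong (lattice-norm² {p -ᴾ q} {i} {j} p-q≈)

  cross-cong : ∀ {p p′ q q′} → p ≈ᴾ p′ → q ≈ᴾ q′ → cross p q ≈ cross p′ q′
  cross-cong (xp , yp) (xq , yq) = +-cong (*-cong xp yq) (-‿cong (*-cong yp xq))

  parallelogram-diagonal : ∀ {a b c d} → b -ᴾ a ≈ᴾ c -ᴾ d → c -ᴾ b ≈ᴾ d -ᴾ a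
  parallelogram-diagonal {a} {b} {c} {d} (xp , yp) = shift xp , shift yp
    where
    shift : ∀ {a b c d} → b - a ≈ c - d → c - b ≈ d - a
    shift {a} {b} {c} {d} eq = begin
      c - b            ≈⟨ solve 3 (λ b c d → c :- b := c :- d :+ (d :- b)) refl b c d ⟩
      c - d + (d - b)  ≈⟨ +-congʳ eq ⟨
      b - a + (d - b)  ≈⟨ solve 3 (λ a b d → b :- a :+ (d :- b) := d :- a) refl a b d ⟩
      d - a            ∎

  shoelace : ∀ {a b c d} → c -ᴾ b ≈ᴾ d -ᴾ a →
    cross a b + cross b c + cross c d + cross d a ≈ fromℤ (+ 2) * cross (b -ᴾ a) (d -ᴾ a)
  shoelace {a} {b} {c} {d} (xc , yc) = begin
    cross a b + cross b c + cross c d + cross d a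
      ≈⟨ +-congʳ (+-cong (+-congˡ (cross-cong ≈ᴾ-refl c≈c′)) (cross-cong c≈c′ ≈ᴾ-refl)) ⟩
    cross a b + cross b c′ + cross c′ d + cross d a
      ≈⟨ solve 6 (λ ax ay bx by dx dy →
           (ax :* by :- ay :* bx) :+ (bx :* (by :+ (dy :- ay)) :- by :* (bx :+ (dx :- ax)))
             :+ ((bx :+ (dx :- ax)) :* dy :- (by :+ (dy :- ay)) :* dx) :+ (dx :* ay :- dy :* ax)
           := con (+ 2) :* ((bx :- ax) :* (dy :- ay) :- (by :- ay) :* (dx :- ax)))
           refl (x a) (y a) (x b) (y b) (x d) (y d) ⟩
    fromℤ (+ 2) * cross (b -ᴾ a) (d -ᴾ a)  ∎
    where
    c′ : Point
    c′ = b +ᴾ (d -ᴾ a)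
    shift : ∀ {b c e} → c - b ≈ e → c ≈ b + e
    shift {b} {c} eq = trans (solve 2 (λ b c → c := b :+ (c :- b)) refl b c) (+-congˡ eq)
    c≈c′ : c ≈ᴾ c′
    c≈c′ = shift xc , shift yc

  -- The first squaring removes the absolute value and √3, giving 4 per² = 3 k². Since per = 2 (s₁ +
  -- s₂), the only radical left is the product s₁ s₂.
  equable⇒L≈32s₁s₂ : ∀ {s₁ s₂ Z n₁ n₂ k} → s₁ * s₁ ≈ n₁ → s₂ * s₂ ≈ n₂ →
    Z ≈ fromℤ (+ 2) * (½ * √3 * k) → s₁ + s₂ + s₁ + s₂ ≈ ½ * ∣ Z ∣ →
    fromℤ (+ 3) * (k * k) - fromℤ (+ 16) * (n₁ + n₂) ≈ fromℤ (+ 32) * (s₁ * s₂)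
  equable⇒L≈32s₁s₂ {s₁} {s₂} {Z} {n₁} {n₂} {k} s₁² s₂² Z≈ eq = begin
    fromℤ (+ 3) * (k * k) - fromℤ (+ 16) * (n₁ + n₂)
      ≈⟨ +-cong (sym 4per²≈3k²) (-‿cong (*-congˡ (+-cong (sym s₁²) (sym s₂²)))) ⟩
    fromℤ (+ 4) * (per * per) - fromℤ (+ 16) * (s₁ * s₁ + s₂ * s₂)
      ≈⟨ solve 2 (λ s t → con (+ 4) :* ((s :+ t :+ s :+ t) :* (s :+ t :+ s :+ t)) :- con (+ 16) :* (s :* s :+ t :* t)
           := con (+ 32) :* (s :* t)) refl s₁ s₂ ⟩
    fromℤ (+ 32) * (s₁ * s₂)  ∎
    where
    per = s₁ + s₂ + s₁ + s₂
    4per²≈3k² : fromℤ (+ 4) * (per * per) ≈ fromℤ (+ 3) * (k * k)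
    4per²≈3k² = begin
      fromℤ (+ 4) * (per * per)
        ≈⟨ *-congˡ (*-cong eq eq) ⟩
      fromℤ (+ 4) * (½ * ∣ Z ∣ * (½ * ∣ Z ∣))
        ≈⟨ solve 2 (λ h z → con (+ 4) :* (h :* z :* (h :* z)) := (h :+ h) :* (h :+ h) :* (z :* z))
             refl ½ ∣ Z ∣ ⟩
      (½ + ½) * (½ + ½) * (∣ Z ∣ * ∣ Z ∣)
        ≈⟨ *-congˡ (trans (∣x∣²≈x² Z) (*-cong Z≈ Z≈)) ⟩
      (½ + ½) * (½ + ½) * (fromℤ (+ 2) * (½ * √3 * k) * (fromℤ (+ 2) * (½ * √3 * k)))
        ≈⟨ solve 3 (λ h r k → (h :+ h) :* (h :+ h) :* (con (+ 2) :* (h :* r :* k) :* (con (+ 2) :* (h :* r :* k)))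
             := (h :+ h) :* (h :+ h) :* ((h :+ h) :* (h :+ h)) :* (r :* r :* (k :* k))) refl ½ √3 k ⟩
      (½ + ½) * (½ + ½) * ((½ + ½) * (½ + ½)) * (√3 * √3 * (k * k))
        ≈⟨ *-cong (*-cong (*-cong 2½≈1 2½≈1) (*-cong 2½≈1 2½≈1)) (*-congʳ √3²≈3) ⟩
      fromℤ (+ 1) * fromℤ (+ 1) * (fromℤ (+ 1) * fromℤ (+ 1)) * (fromℤ (+ 3) * (k * k))
        ≈⟨ solve 1 (λ s → con (+ 1) :* con (+ 1) :* (con (+ 1) :* con (+ 1)) :* s := s)
             refl (fromℤ (+ 3) * (k * k)) ⟩
      fromℤ (+ 3) * (k * k)  ∎

  -- Multiplying by 2 √3 instead of dividing by √3 / 2 turns the hypothesis into 3 (i + j) = 0, an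
  -- equation between integers.
  y-opposite : ∀ i j → fromℤ i * (½ * √3) + fromℤ j * (½ * √3) ≈ 0# → j ≡ ℤ.- i
  y-opposite i j eq = ≡.trans (add-back i j) (≡.trans (≡.cong (ℤ._- i) i+j≡0) (ℤₚ.+-identityˡ (ℤ.- i)))
    where
    add-back : ∀ i j → j ≡ i ℤ.+ j ℤ.- i
    add-back = solve-∀
    i+j≡0 : i ℤ.+ j ≡ 0ℤ
    i+j≡0 = ℤₚ.*-cancelˡ-≡ (+ 3) (i ℤ.+ j) 0ℤ (fromℤ≈0 (+ 3 ℤ.* (i ℤ.+ j)) (begin
      fromℤ (+ 3 ℤ.* (i ℤ.+ j))
        ≈⟨ trans (fromℤ-* (+ 3) (i ℤ.+ j)) (*-cong (sym √3²≈3) (fromℤ-+ i j)) ⟩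
      √3 * √3 * (fromℤ i + fromℤ j)
        ≈⟨ solve 2 (λ r s → r :* r :* s := con (+ 1) :* r :* r :* s) refl √3 (fromℤ i + fromℤ j) ⟩
      fromℤ (+ 1) * √3 * √3 * (fromℤ i + fromℤ j)
        ≈⟨ *-congʳ (*-congʳ (*-congʳ 2½≈1)) ⟨
      (½ + ½) * √3 * √3 * (fromℤ i + fromℤ j)
        ≈⟨ solve 4 (λ h r i j → (h :+ h) :* r :* r :* (i :+ j)
             := con (+ 2) :* r :* (i :* (h :* r) :+ j :* (h :* r)))
             refl ½ √3 (fromℤ i) (fromℤ j) ⟩
      fromℤ (+ 2) * √3 * (fromℤ i * (½ * √3) + fromℤ j * (½ * √3))
        ≈⟨ trans (*-congˡ eq) (zeroʳ _) ⟩
      0#  ∎))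

  -- Parallelograms with horizontal diagonal ac

  record Spanned (a b c d : Point) : Set ℓ₁ where
    field
      -- One `β` serves both sides: their sum is the diagonal ac, which is horizontal and so has no
      -- ω-component.
      α₁ α₂ β : ℤ
      b-a≈ : b -ᴾ a ≈ᴾ ⟦ α₁ , β ⟧
      d-a≈ : d -ᴾ a ≈ᴾ ⟦ α₂ , ℤ.- β ⟧
      c-d≈ : c -ᴾ d ≈ᴾ ⟦ α₁ , β ⟧
      c-b≈ : c -ᴾ b ≈ᴾ ⟦ α₂ , ℤ.- β ⟧

  spanned : ∀ {a b c d} → IsParallelogram (quad a b c d) → HasEisensteinVertices (quad a b c d) →
    Horizontal a c → Spanned a b c d
  spanned {a} {b} {c} {d} (b-a≈c-d , _) ((a₁ , a₂ , a≈) , (b₁ , b₂ , b≈) , _ , (d₁ , d₂ , d≈)) ya≈yc = record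
    { α₁ = b₁ ℤ.- a₁ ; α₂ = d₁ ℤ.- a₁ ; β = b₂ ℤ.- a₂
    ; b-a≈ = b-a≈
    ; d-a≈ = d-a≈
    ; c-d≈ = ≈ᴾ-sym b-a≈c-d ⨾ b-a≈
    ; c-b≈ = c-b≈d-a ⨾ d-a≈
    }
    where
    c-b≈d-a : c -ᴾ b ≈ᴾ d -ᴾ a
    c-b≈d-a = parallelogram-diagonal b-a≈c-d
    b-a≈ : b -ᴾ a ≈ᴾ ⟦ b₁ ℤ.- a₁ , b₂ ℤ.- a₂ ⟧
    b-a≈ = lattice-difference {b} {a} {b₁} {b₂} {a₁} {a₂} b≈ a≈
    d-a≈′ : d -ᴾ a ≈ᴾ ⟦ d₁ ℤ.- a₁ , d₂ ℤ.- a₂ ⟧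
    d-a≈′ = lattice-difference {d} {a} {d₁} {d₂} {a₁} {a₂} d≈ a≈
    opposite : d₂ ℤ.- a₂ ≡ ℤ.- (b₂ ℤ.- a₂)
    opposite = y-opposite (b₂ ℤ.- a₂) (d₂ ℤ.- a₂) (begin
      fromℤ (b₂ ℤ.- a₂) * (½ * √3) + fromℤ (d₂ ℤ.- a₂) * (½ * √3)
        ≈⟨ +-cong (y-coordinate {b -ᴾ a} {b₁ ℤ.- a₁} {b₂ ℤ.- a₂} b-a≈)
                 (y-coordinate {d -ᴾ a} {d₁ ℤ.- a₁} {d₂ ℤ.- a₂} d-a≈′) ⟨
      y b - y a + (y d - y a)     ≈⟨ +-congˡ (proj₂ c-b≈d-a) ⟨
      y b - y a + (y c - y b)     ≈⟨ solve 3 (λ a b c → b :- a :+ (c :- b) := c :- a)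
           refl (y a) (y b) (y c) ⟩
      y c - y a                   ≈⟨ +-congˡ (-‿cong ya≈yc) ⟩
      y c - y c                   ≈⟨ -‿inverseʳ (y c) ⟩
      0#                          ∎)
    d-a≈ : d -ᴾ a ≈ᴾ ⟦ d₁ ℤ.- a₁ , ℤ.- (b₂ ℤ.- a₂) ⟧
    d-a≈ = ≡.subst (λ j → d -ᴾ a ≈ᴾ ⟦ d₁ ℤ.- a₁ , j ⟧) opposite d-a≈′

  module _ {a b c d : Point} (S : Spanned a b c d)
    (nondegenerate : ¬ (cross (b -ᴾ a) (d -ᴾ a) ≈ 0#)) (equable : Equable (quad a b c d)) where
    open Spanned S

    private
      n₁ n₂ k l : ℤ
      n₁ = N₁ α₁ α₂ β
      n₂ = N₂ α₁ α₂ β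
      k = K α₁ α₂ β
      l = L α₁ α₂ β

    norm₂ : α₂ ℤ.* α₂ ℤ.- α₂ ℤ.* (ℤ.- β) ℤ.+ (ℤ.- β) ℤ.* (ℤ.- β) ≡ n₂
    norm₂ = lemma α₂ β
      where
      lemma : ∀ α β → α ℤ.* α ℤ.- α ℤ.* (ℤ.- β) ℤ.+ (ℤ.- β) ℤ.* (ℤ.- β) ≡ α ℤ.* α ℤ.+ α ℤ.* β ℤ.+ β ℤ.* β
      lemma = solve-∀

    s₁ s₂ : Carrier
    s₁ = √ fromℤ n₁
    s₂ = √ fromℤ n₂

    0≤n₁ : 0# ≤ fromℤ n₁
    0≤n₁ = 0≤fromℤ (0≤i²-ij+j² α₁ β)

    0≤n₂ : 0# ≤ fromℤ n₂
    0≤n₂ = 0≤fromℤ (≡.subst (0ℤ ℤ.≤_) norm₂ (0≤i²-ij+j² α₂ (ℤ.- β)))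

    dist₁ : ∀ p q → p -ᴾ q ≈ᴾ ⟦ α₁ , β ⟧ → dist p q ≈ s₁
    dist₁ p q = lattice-dist {p} {q} {α₁} {β}

    dist₂ : ∀ p q → p -ᴾ q ≈ᴾ ⟦ α₂ , ℤ.- β ⟧ → dist p q ≈ s₂
    dist₂ p q p-q≈ = trans (lattice-dist {p} {q} {α₂} {ℤ.- β} p-q≈) (√-cong (fromℤ-cong norm₂))

    perimeter≈ : perimeter (quad a b c d) ≈ s₁ + s₂ + s₁ + s₂
    perimeter≈ = +-cong (+-cong (+-cong
      (trans (dist-sym a b) (dist₁ b a b-a≈)) (trans (dist-sym b c) (dist₂ c b c-b≈)))
      (dist₁ c d c-d≈)) (dist₂ d a d-a≈)

    cross≈ : cross (b -ᴾ a) (d -ᴾ a) ≈ ½ * √3 * fromℤ (ℤ.- k)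
    cross≈ = trans (lattice-cross {b -ᴾ a} {d -ᴾ a} {α₁} {β} {α₂} {ℤ.- β} b-a≈ d-a≈)
                   (*-congˡ (fromℤ-cong (determinant α₁ α₂ β)))
      where
      determinant : ∀ α₁ α₂ β → α₁ ℤ.* (ℤ.- β) ℤ.- β ℤ.* α₂ ≡ ℤ.- (β ℤ.* (α₁ ℤ.+ α₂))
      determinant = solve-∀

    k≢0 : k ≢ 0ℤ
    k≢0 k≡0 = nondegenerate (trans cross≈ (trans (*-congˡ (fromℤ-cong (≡.cong ℤ.-_ k≡0))) (zeroʳ _)))

    l≈32s₁s₂ : fromℤ l ≈ fromℤ (+ 32) * (s₁ * s₂)
    l≈32s₁s₂ = begin
      fromℤ (+ 3 ℤ.* (k ℤ.* k) ℤ.- + 16 ℤ.* (n₁ ℤ.+ n₂))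
        ≈⟨ fromℤ-cong (lemma k n₁ n₂) ⟩
      fromℤ (+ 3 ℤ.* (ℤ.- k ℤ.* ℤ.- k) ℤ.- + 16 ℤ.* (n₁ ℤ.+ n₂))
        ≈⟨ fromℤ-minus (+ 3 ℤ.* (ℤ.- k ℤ.* ℤ.- k)) (+ 16 ℤ.* (n₁ ℤ.+ n₂)) ⟩
      fromℤ (+ 3 ℤ.* (ℤ.- k ℤ.* ℤ.- k)) - fromℤ (+ 16 ℤ.* (n₁ ℤ.+ n₂))
        ≈⟨ +-cong (trans (fromℤ-* (+ 3) (ℤ.- k ℤ.* ℤ.- k)) (*-congˡ (fromℤ-* (ℤ.- k) (ℤ.- k))))
                  (-‿cong (trans (fromℤ-* (+ 16) (n₁ ℤ.+ n₂)) (*-congˡ (fromℤ-+ n₁ n₂)))) ⟩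
      fromℤ (+ 3) * (fromℤ (ℤ.- k) * fromℤ (ℤ.- k)) - fromℤ (+ 16) * (fromℤ n₁ + fromℤ n₂)
        ≈⟨ equable⇒L≈32s₁s₂ (√-square 0≤n₁) (√-square 0≤n₂)
             (trans (shoelace {a} {b} {c} {d} c-b≈d-a) (*-congˡ cross≈)) (trans (sym perimeter≈) equable) ⟩
      fromℤ (+ 32) * (s₁ * s₂)  ∎
      where
      c-b≈d-a : c -ᴾ b ≈ᴾ d -ᴾ a
      c-b≈d-a = c-b≈ ⨾ ≈ᴾ-sym d-a≈
      lemma : ∀ k n₁ n₂ → + 3 ℤ.* (k ℤ.* k) ℤ.- + 16 ℤ.* (n₁ ℤ.+ n₂)
        ≡ + 3 ℤ.* (ℤ.- k ℤ.* ℤ.- k) ℤ.- + 16 ℤ.* (n₁ ℤ.+ n₂)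
      lemma = solve-∀

    -- `l` is 32 times a product of nonnegative roots; this keeps the sign that the squaring in
    -- `l²≡1024n₁n₂` forgets.
    0≤l : 0ℤ ℤ.≤ l
    0≤l = 0≤fromℤ⁻¹ l (≤-respʳ-≈ (sym l≈32s₁s₂)
      (0≤xy (0≤fromℤ {+ 32} (ℤ.+≤+ ℕ.z≤n)) (0≤xy (√-nonneg 0≤n₁) (√-nonneg 0≤n₂))))

    l²≡1024n₁n₂ : l ℤ.* l ≡ + 1024 ℤ.* (n₁ ℤ.* n₂)
    l²≡1024n₁n₂ = fromℤ-injective (l ℤ.* l) (+ 1024 ℤ.* (n₁ ℤ.* n₂)) (begin
      fromℤ (l ℤ.* l)                                                ≈⟨ fromℤ-* l l ⟩
      fromℤ l * fromℤ l                                              ≈⟨ *-cong l≈32s₁s₂ l≈32s₁s₂ ⟩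
      fromℤ (+ 32) * (s₁ * s₂) * (fromℤ (+ 32) * (s₁ * s₂))
        ≈⟨ solve 3 (λ m s t → m :* (s :* t) :* (m :* (s :* t)) := m :* m :* ((s :* s) :* (t :* t)))
             refl (fromℤ (+ 32)) s₁ s₂ ⟩
      fromℤ (+ 32) * fromℤ (+ 32) * ((s₁ * s₁) * (s₂ * s₂))
        ≈⟨ *-cong (sym (fromℤ-* (+ 32) (+ 32))) (*-cong (√-square 0≤n₁) (√-square 0≤n₂)) ⟩
      fromℤ (+ 1024) * (fromℤ n₁ * fromℤ n₂)
        ≈⟨ trans (fromℤ-* (+ 1024) (n₁ ℤ.* n₂)) (*-congˡ (fromℤ-* n₁ n₂)) ⟨
      fromℤ (+ 1024 ℤ.* (n₁ ℤ.* n₂))                                 ∎)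

  -- The congruence with `P n`

  scale-x : ∀ {v i j} ε m → v ≈ᴾ ⟦ i , j ⟧ → ε ℤ.* (+ 2 ℤ.* i ℤ.- j) ≡ + 2 ℤ.* m → fromℤ ε * x v ≈ fromℤ m
  scale-x {v} {i} {j} ε m v≈ eq = begin
    e * x v
      ≈⟨ *-congˡ (x-coordinate {v} {i} {j} v≈) ⟩
    e * (a - b * ½)
      ≈⟨ solve 4 (λ e a b h → e :* (a :- b :* h) := e :* (con (+ 1) :* a :- b :* h)) refl e a b ½ ⟩
    e * (fromℤ (+ 1) * a - b * ½)
      ≈⟨ *-congˡ (+-congʳ (*-congʳ 2½≈1)) ⟨
    e * ((½ + ½) * a - b * ½)
      ≈⟨ solve 4 (λ e a b h → e :* ((h :+ h) :* a :- b :* h) := h :* (e :* (con (+ 2) :* a :- b)))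
           refl e a b ½ ⟩
    ½ * (e * (fromℤ (+ 2) * a - b))
      ≈⟨ *-congˡ (trans (fromℤ-* ε (+ 2 ℤ.* i ℤ.- j)) (*-congˡ
           (trans (fromℤ-minus (+ 2 ℤ.* i) j) (+-congʳ (fromℤ-* (+ 2) i))))) ⟨
    ½ * fromℤ (ε ℤ.* (+ 2 ℤ.* i ℤ.- j))
      ≈⟨ *-congˡ (trans (fromℤ-cong eq) (fromℤ-* (+ 2) m)) ⟩
    ½ * (fromℤ (+ 2) * fromℤ m)
      ≈⟨ solve 2 (λ h m → h :* (con (+ 2) :* m) := (h :+ h) :* m) refl ½ (fromℤ m) ⟩
    (½ + ½) * fromℤ m
      ≈⟨ trans (*-congʳ ½+½≈1) (*-identityˡ _) ⟩
    fromℤ m  ∎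
    where
    e = fromℤ ε
    a = fromℤ i
    b = fromℤ j

  scale-y : ∀ {v i j} δ m → v ≈ᴾ ⟦ i , j ⟧ → δ ℤ.* j ≡ + 2 ℤ.* m → fromℤ δ * y v ≈ fromℤ m * √3
  scale-y {v} {i} {j} δ m v≈ eq = begin
    fromℤ δ * y v
      ≈⟨ *-congˡ (y-coordinate {v} {i} {j} v≈) ⟩
    fromℤ δ * (fromℤ j * (½ * √3))
      ≈⟨ *-assoc _ _ _ ⟨
    fromℤ δ * fromℤ j * (½ * √3)
      ≈⟨ *-congʳ (trans (sym (fromℤ-* δ j)) (trans (fromℤ-cong eq) (fromℤ-* (+ 2) m))) ⟩
    fromℤ (+ 2) * fromℤ m * (½ * √3)
      ≈⟨ solve 3 (λ h m r → con (+ 2) :* m :* (h :* r) := (h :+ h) :* (m :* r)) refl ½ (fromℤ m) √3 ⟩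
    (½ + ½) * (fromℤ m * √3)
      ≈⟨ trans (*-congʳ ½+½≈1) (*-identityˡ _) ⟩
    fromℤ m * √3  ∎

  -- For ε, δ = ± 1 this translates `a` to the origin and reflects in the coordinate axes. With
  -- integers as signs, the isometry property reduces to ε² = δ² = 1.
  flip : ℤ → ℤ → Point → Point → Point
  flip ε δ a p = ⟨ fromℤ ε * (x p - x a) , fromℤ δ * (y p - y a) ⟩

  flip-isometry : ∀ ε δ a → Unit ε → Unit δ → IsIsometry (flip ε δ a)
  flip-isometry ε δ a ε²≡1 δ²≡1 p q = √-cong (+-cong (square ε ε²≡1) (square δ δ²≡1))
    where
    square : ∀ ε {s t o} → Unit ε →
      (fromℤ ε * (s - o) - fromℤ ε * (t - o)) * (fromℤ ε * (s - o) - fromℤ ε * (t - o)) ≈ (s - t) * (s - t)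
    square ε {s} {t} {o} ε²≡1 = begin
      (fromℤ ε * (s - o) - fromℤ ε * (t - o)) * (fromℤ ε * (s - o) - fromℤ ε * (t - o))
        ≈⟨ solve 4 (λ e s t o → (e :* (s :- o) :- e :* (t :- o)) :* (e :* (s :- o) :- e :* (t :- o))
             := e :* e :* ((s :- t) :* (s :- t))) refl (fromℤ ε) s t o ⟩
      fromℤ ε * fromℤ ε * ((s - t) * (s - t))
        ≈⟨ *-congʳ (trans (sym (fromℤ-* ε ε)) (fromℤ-cong ε²≡1)) ⟩
      fromℤ (+ 1) * ((s - t) * (s - t))
        ≈⟨ trans (*-congʳ (+-identityʳ 1#)) (*-identityˡ _) ⟩
      (s - t) * (s - t)  ∎

  -2√3≈ : fromℤ (ℤ.- + 2) * √3 ≈ - 2√3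
  -2√3≈ = sym (-‿distribˡ-* _ _)

  Congruent-rotate : ∀ {a b c d R} → Congruent (quad b c d a) R → Congruent (quad a b c d) R
  Congruent-rotate (f , isometry , polygon) = f , isometry , rotate polygon

  congruent : ∀ {a b c d} (S : Spanned a b c d) → Horizontal a c →
    Shape (Spanned.α₁ S) (Spanned.α₂ S) (Spanned.β S) → ∃[ n ] Congruent (quad a b c d) (P n)
  congruent {a} {b} {c} {d} S ya≈yc H = n , flip ε δ a , flip-isometry ε δ a ε²≡1 δ²≡1 , polygon position
    where
    open Spanned S
    open Shape H

    f : Point → Point
    f = flip ε δ a

    u₀ u₁ : ℤ
    u₀ = + 6 ℤ.* u n
    u₁ = + 6 ℤ.* u (suc n)

    fa≈O : f a ≈ᴾ O
    fa≈O = vanish (fromℤ ε) (x a) , vanish (fromℤ δ) (y a)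
      where
      vanish : ∀ e s → e * (s - s) ≈ 0#
      vanish e s = trans (*-congˡ (-‿inverseʳ s)) (zeroʳ e)

    -- `m₁` and `m₂` are kept general because the two cases of `position` interchange them.
    fc≈ : ∀ m₁ m₂ → fromℤ ε * (x b - x a) ≈ fromℤ m₁ → fromℤ ε * (x c - x b) ≈ fromℤ m₂ →
      m₁ ℤ.+ m₂ ≡ u₁ ℤ.- u₀ → f c ≈ᴾ B n
    fc≈ m₁ m₂ p q m₁+m₂≡ = xc , trans (*-congˡ (trans (+-congʳ (sym ya≈yc)) (-‿inverseʳ (y a)))) (zeroʳ _)
      where
      xc : fromℤ ε * (x c - x a) ≈ fromℤ (u₁ ℤ.- u₀)
      xc = begin
        fromℤ ε * (x c - x a)
          ≈⟨ solve 4 (λ e a b c → e :* (c :- a) := e :* (b :- a) :+ e :* (c :- b))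
               refl (fromℤ ε) (x a) (x b) (x c) ⟩
        fromℤ ε * (x b - x a) + fromℤ ε * (x c - x b)
          ≈⟨ +-cong p q ⟩
        fromℤ m₁ + fromℤ m₂
          ≈⟨ trans (sym (fromℤ-+ m₁ m₂)) (fromℤ-cong m₁+m₂≡) ⟩
        fromℤ (u₁ ℤ.- u₀)  ∎

    scale-b : ∀ m → ε ℤ.* (+ 2 ℤ.* α₁ ℤ.- β) ≡ + 2 ℤ.* m → fromℤ ε * (x b - x a) ≈ fromℤ m
    scale-b m = scale-x {b -ᴾ a} {α₁} {β} ε m b-a≈

    scale-w : ∀ m v → v ≈ᴾ ⟦ α₂ , ℤ.- β ⟧ → ε ℤ.* (+ 2 ℤ.* α₂ ℤ.+ β) ≡ + 2 ℤ.* m → fromℤ ε * x v ≈ fromℤ m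
    scale-w m v v≈ eq = scale-x {v} {α₂} {ℤ.- β} ε m v≈
      (≡.trans (≡.cong (λ t → ε ℤ.* (+ 2 ℤ.* α₂ ℤ.+ t)) (ℤₚ.neg-involutive β)) eq)

    y₁ : ∀ m → δ ℤ.* β ≡ + 2 ℤ.* m → fromℤ δ * (y b - y a) ≈ fromℤ m * √3
    y₁ m = scale-y {b -ᴾ a} {α₁} {β} δ m b-a≈

    y₂ : ∀ m → δ ℤ.* β ≡ ℤ.- (+ 2 ℤ.* m) → fromℤ δ * (y d - y a) ≈ fromℤ m * √3
    y₂ m eq = scale-y {d -ᴾ a} {α₂} {ℤ.- β} δ m d-a≈
      (≡.trans (≡.sym (ℤₚ.neg-distribʳ-* δ β)) (≡.trans (≡.cong ℤ.-_ eq) (ℤₚ.neg-involutive (+ 2 ℤ.* m))))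

    double-u : ∀ t → + 12 ℤ.* t ≡ + 2 ℤ.* (+ 6 ℤ.* t)
    double-u = solve-∀

    double-neg-u : ∀ t → ℤ.- (+ 12 ℤ.* t) ≡ + 2 ℤ.* (ℤ.- (+ 6 ℤ.* t))
    double-neg-u = solve-∀

    polygon : _ → SamePolygon (mapᵠ f (quad a b c d)) (P n)
    polygon (inj₁ (p , q , r)) =
      -- Here `d` lands on `A n` and `b` on `C n`, so the vertices have to be read in the order a,
      -- d, c, b. In the other case the given order already fits.
      reverse (rotate (rotate (rotate (same fa≈O (xd , yd) fc≈B (xb , y₁ (+ 2) r)))))
      where
      xb = scale-b u₁ (≡.trans p (double-u (u (suc n))))
      q′ = ≡.trans q (double-neg-u (u n))
      xd = scale-w (ℤ.- u₀) (d -ᴾ a) d-a≈ q′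
      yd = trans (y₂ (ℤ.- + 2) r) -2√3≈
      fc≈B = fc≈ u₁ (ℤ.- u₀) xb (scale-w (ℤ.- u₀) (c -ᴾ b) c-b≈ q′) ≡.refl
    polygon (inj₂ (p , q , r)) = same fa≈O (xb , trans (y₁ (ℤ.- + 2) r) -2√3≈) fc≈B (xd , y₂ (+ 2) r)
      where
      xb = scale-b (ℤ.- u₀) (≡.trans p (double-neg-u (u n)))
      q′ = ≡.trans q (double-u (u (suc n)))
      xd = scale-w u₁ (d -ᴾ a) d-a≈ q′
      fc≈B = fc≈ (ℤ.- u₀) u₁ xb (scale-w u₁ (c -ᴾ b) c-b≈ q′) (ℤₚ.+-comm (ℤ.- u₀) u₁)

  -- Relabelling the vertices to exchange the two diagonals

  IsELEP-rotate : ∀ {a b c d} → IsELEP (quad a b c d) → IsELEP (quad b c d a)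
  IsELEP-rotate {a} {b} {c} {d} Q = record
    { isParallelogram = c-b≈d-a , λ eq → proj₂ isParallelogram (trans (sym turn) eq)
    ; equable = begin
        dist b c + dist c d + dist d a + dist a b
          ≈⟨ solve 4 (λ p q r s → q :+ r :+ s :+ p := p :+ q :+ r :+ s)
               refl (dist a b) (dist b c) (dist c d) (dist d a) ⟩
        perimeter (quad a b c d)
          ≈⟨ equable ⟩
        area (quad a b c d)
          ≈⟨ *-congˡ (∣∣-cong (solve 4 (λ p q r s → p :+ q :+ r :+ s := q :+ r :+ s :+ p)
               refl (cross a b) (cross b c) (cross c d) (cross d a))) ⟩
        area (quad b c d a)  ∎
    ; hasEisensteinVertices = let p , q , r , s = hasEisensteinVertices in q , r , s , p
    }
    where
    open IsELEP Q
    c-b≈d-a : c -ᴾ b ≈ᴾ d -ᴾ a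
    c-b≈d-a = parallelogram-diagonal (proj₁ isParallelogram)
    turn : cross (c -ᴾ b) (a -ᴾ b) ≈ cross (b -ᴾ a) (d -ᴾ a)
    turn = begin
      cross (c -ᴾ b) (a -ᴾ b)    ≈⟨ cross-cong c-b≈d-a ≈ᴾ-refl ⟩
      cross (d -ᴾ a) (a -ᴾ b)
        ≈⟨ solve 6 (λ ax ay bx by dx dy → (dx :- ax) :* (ay :- by) :- (dy :- ay) :* (ax :- bx)
             := (bx :- ax) :* (dy :- ay) :- (by :- ay) :* (dx :- ax)) refl (x a) (y a) (x b) (y b) (x d) (y d) ⟩
      cross (b -ᴾ a) (d -ᴾ a)    ∎

  horizontal-ac : ∀ {a b c d} → IsELEP (quad a b c d) → Horizontal a c →
    ∃[ n ] Congruent (quad a b c d) (P n)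
  horizontal-ac {a} {b} {c} {d} Q ya≈yc = congruent S ya≈yc (shape α₁ α₂ β
    (k≢0 S nondegenerate equable) (0≤l S nondegenerate equable) (l²≡1024n₁n₂ S nondegenerate equable))
    where
    open IsELEP Q
    S : Spanned a b c d
    S = spanned isParallelogram hasEisensteinVertices ya≈yc
    open Spanned S
    nondegenerate = proj₂ isParallelogram

theorem5 : ∀ {c ℓ₁ ℓ₂} (ℝ : RealNumbers c ℓ₁ ℓ₂) → let open Plane ℝ in
    (Q : Quadrilateral) → IsELEP Q → HasHorizontalDiagonal Q →
    ∃[ n ] Congruent Q (P n)
theorem5 ℝ (Plane.quad a b c d) Q (inj₁ ya≈yc) = Geometry.horizontal-ac ℝ Q ya≈yc
theorem5 ℝ (Plane.quad a b c d) Q (inj₂ yb≈yd) =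
  let n , congruent = Geometry.horizontal-ac ℝ (Geometry.IsELEP-rotate ℝ Q) yb≈yd
  in n , Geometry.Congruent-rotate ℝ congruent
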